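{- Consider $\Omega, F=\{f_1,\dots,f_m\}, D,\rho,\theta$, let $\mu$ be a probability measure on $\Omega$ with $\mu(\sigma)>0$ for all $\sigma$, and let $\gamma_i$ be the charge of $f_i$, as defined in the context. Suppose algorithm $\mathcal{A}$ results by applying a traceable flaw-choice mechanism on $(D,\rho,\theta)$, with associated families $\mathrm{Roots}(\theta)\subseteq 2^F$ and $\mathrm{List}(f_1),\dots,\mathrm{List}(f_m)\subseteq 2^F$. If there exist positive real numbers $\{\psi_i\}_{i=1}^m$ such that for every flaw $f_i\in F$, $$\zeta_i := \frac{\gamma_i}{\psi_i}\sum_{S\in\mathrm{List}(f_i)}\ \prod_{j\in S}\psi_j<1,$$ then for every $s\ge 0$ a sink of $D$ is reached by $\mathcal{A}$ within $(T_0+s)/\delta$ steps with probability at least $1-2^{ -s}$, where $\delta=1-\max_{i\in[m]}\zeta_i$ and $$T_0=\log_2\left(\max_{\sigma\in\Omega}\frac{\theta(\sigma)}{\mu(\sigma)}\right)+\log_2\left(\sum_{S\in\mathrm{Roots}(\theta)}\ \prod_{j\in S}\psi_j\right).$$ (If $T_0+s<0$, the bound on the number of steps is read as $0$.)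
   Context: $\Omega$ is a finite set of states and $F=\{f_1,\dots,f_m\}$ is a collection of non-empty subsets of $\Omega$ called flaws; flaws are identified with their indices in $[m]$. For $\sigma\in\Omega$, $U(\sigma)=\{f\in F:\sigma\in f\}$ is the set of flaws present in $\sigma$; $\sigma$ is flawless if $U(\sigma)=\emptyset$. For every $\sigma$ and every $f_i\in U(\sigma)$ a non-empty set $A(i,\sigma)\subseteq\Omega$ of actions, with $A(i,\sigma)\neq\{\sigma\}$, is given. $D$ is the multi-digraph on $\Omega$ having an arc $\sigma\xrightarrow{i}\tau$ for every $f_i\in U(\sigma)$ and $\tau\in A(i,\sigma)$; its sinks are exactly the flawless states. For $\sigma\in f_i$, $\rho_i(\sigma,\cdot)$ is a probability distribution on $A(i,\sigma)$ (with $\rho_i(\sigma,\tau)=0$ for $\tau\notin A(i,\sigma)$). $\theta$ is a probability distribution on $\Omega$. Empty products equal $1$. The walk: the initial state $\sigma_1$ is chosen according to $\theta$; at each non-sink state $\sigma$ the algorithm first selects a flaw $f_i\in U(\sigma)$ as a function of the trajectory so far (the flaw-choice mechanism) and then moves to $\tau\in A(i,\sigma)$ with probability $\rho_i(\sigma,\tau)$ (one step; $f_i$ is said to be addressed). It stops at a sink. The witness sequence of a trajectory is the sequence of flaws addressed along it; $\mathcal{W}_t$ is the set of all length-$t$ prefixes of witness sequences that can occur (for trajectories having at least $t$ steps). Traceability: a flaw-choice mechanism is traceable, given $(D,\rho,\theta)$, if there exist sets $\mathrm{Roots}(\theta)\subseteq 2^F$ and $\mathrm{List}(f_1),\dots,\mathrm{List}(f_m)\subseteq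 2^F$ such that for every $t\ge1$ the set $\mathcal{W}_t$ can be injected into unordered rooted forests with $t$ vertices having the following properties: (1) each vertex is labeled by a flaw in $F$, the labels of the $t$ vertices being, with multiplicity, the $t$ flaws of the witness sequence mapped to the forest; (2) the flaws labeling the roots are distinct and form an element of $\mathrm{Roots}(\theta)$; (3) the flaws labeling the children of each vertex are distinct; (4) if a vertex is labeled by $f_i$, then the labels of its children form an element of $\mathrm{List}(f_i)$. Charges: $b_i^\tau=|\{\sigma\in f_i:\tau\in A(i,\sigma)\}|$ and $b_i=\max_{\tau\in\Omega} b_i^\tau$. $D$ is atomic if $b_i=1$ for all $i$. $(D,\rho)$ regenerate $\mu$ at $f_i$ if $\frac{1}{\mu(f_i)}\sum_{\sigma\in f_i}\mu(\sigma)\rho_i(\sigma,\tau)=\mu(\tau)$ for every $\tau\in\Omega$. If $(D,\rho)$ regenerate $\mu$ at every $f_i\in F$ and either $\theta=\mu$ or $D$ is atomic (regenerative case), then $\gamma_i=\mu(f_i)$. Otherwise (general case) $\gamma_i=b_i\max_{\sigma\in f_i}\lambda_i^\sigma$ where $\lambda_i^\sigma=\max_{\tau\in A(i,\sigma)}\left\{\rho_i(\sigma,\tau)\frac{\mu(\sigma)}{\mu(\tau)}\right\}$. -}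

module Defs where

open import Algebra.Bundles using (CommutativeRing)
import Algebra.Construct.NaturalChoice.Max as NaturalChoice
import Algebra.Definitions.RawMonoid as RawMonoid
open import Data.Fin.Base using (Fin)
import Data.Fin.Properties as Fin
open import Data.Fin.Subset using (Subset; _∈_; _∉_; ⁅_⁆; ⋃; Nonempty)
open import Data.Fin.Subset.Properties using (_∈?_)
open import Data.List.Base using (List; []; _∷_; _++_; _∷ʳ_; map; filter; foldr; concatMap; allFin; length)
import Data.List.Extrema as Extrema
import Data.List.Extrema.Nat as ℕExtrema
import Data.List.Membership.Propositional as List
open import Data.List.Relation.Binary.Permutation.Homogeneous using (Permutation)
open import Data.List.Relation.Binary.Permutation.Propositional using (_↭_)
open import Data.List.Relation.Unary.All using (All)
open import Data.List.Relation.Unary.Unique.Propositional using (Unique)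
import Data.Nat.Base as ℕ
open ℕ using (ℕ; zero; suc)
import Data.Nat.Properties as ℕ
open import Data.Product.Base using (_×_; _,_; proj₁; proj₂; ∃; ∃-syntax; Σ-syntax)
open import Data.Sum.Base using (_⊎_)
open import Data.Vec.Base using (lookup; tabulate)
open import Function.Base using (_∘_)
open import Level using (0ℓ)
open import Relation.Binary.Bundles using (TotalOrder)
open import Relation.Binary.Core using (Rel)
open import Relation.Binary.PropositionalEquality.Core using (_≡_; _≢_)
open import Relation.Binary.Structures using (IsDecTotalOrder)
import Relation.Binary.Construct.NonStrictToStrict as NonStrictToStrict
open import Relation.Nullary using (¬_; Dec; yes; no)
open import Relation.Nullary.Decidable using (does; ¬?; _×-dec_; _⊎-dec_)
open import Relation.Unary using (Pred; Decidable)
open import Data.Bool.Base using (if_then_else_)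

-- The (classical) field of real numbers, which is characterised up to
-- unique isomorphism as the Dedekind-complete totally ordered field.
-- Equality is a setoid equality.  As usual in proof assistants, _⁻¹ is
-- total and nothing is assumed about the inverse of zero.

record CompleteOrderedField : Set₁ where
  infix  8 _⁻¹
  infixl 7 _/_
  infix  4 _≤_

  field
    commutativeRing : CommutativeRing 0ℓ 0ℓ

  open CommutativeRing commutativeRing public
    using (_≈_; _+_; _*_; _-_; -_; 0#; 1#)
    renaming (Carrier to ℝ)

  field
    _≤_             : Rel ℝ 0ℓ
    isDecTotalOrder : IsDecTotalOrder _≈_ _≤_
    +-monoˡ-≤       : ∀ {x y} z → x ≤ y → x + z ≤ y + z
    *-nonNegative   : ∀ {x y} → 0# ≤ x → 0# ≤ y → 0# ≤ x * y
    0≉1             : ¬ (0# ≈ 1#)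
    _⁻¹             : ℝ → ℝ
    ⁻¹-cong         : ∀ {x y} → x ≈ y → x ⁻¹ ≈ y ⁻¹
    ⁻¹-inverse      : ∀ {x} → ¬ (x ≈ 0#) → x * x ⁻¹ ≈ 1#

  UpperBound : Pred ℝ 0ℓ → ℝ → Set
  UpperBound P u = ∀ {x} → P x → x ≤ u

  field
    supremum : (P : Pred ℝ 0ℓ) → ∃ P → ∃ (UpperBound P) →
               ∃[ s ] UpperBound P s × (∀ {u} → UpperBound P u → s ≤ u)

  open IsDecTotalOrder isDecTotalOrder public
    using (_≤?_) renaming (_≟_ to _≈?_; isTotalOrder to ≤-isTotalOrder)

  open NonStrictToStrict _≈_ _≤_ public using (_<_)

  ≤-totalOrder : TotalOrder 0ℓ 0ℓ 0ℓ
  ≤-totalOrder = record { isTotalOrder = ≤-isTotalOrder }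

  _/_ : ℝ → ℝ → ℝ
  x / y = x * y ⁻¹

  fromℕ : ℕ → ℝ
  fromℕ k = k · 1#
    where open RawMonoid (CommutativeRing.+-rawMonoid commutativeRing)
            using () renaming (_×_ to _·_)

  -- k is the integer part of the non-negative real x.
  IsFloor : ℕ → ℝ → Set
  IsFloor k x = fromℕ k ≤ x × x < fromℕ (suc k)

  sumOver : {A : Set} → List A → (A → ℝ) → ℝ
  sumOver xs f = foldr _+_ 0# (map f xs)

  productOver : {A : Set} → List A → (A → ℝ) → ℝ
  productOver xs f = foldr _*_ 1# (map f xs)

  -- The maximum of a family of non-negative reals.  All families it is
  -- used for are non-negative, so starting at 0 only matters if xs is
  -- empty, in which case the maximum is 0.
  maxOver : {A : Set} → List A → (A → ℝ) → ℝ
  maxOver xs f = Extrema.max ≤-totalOrder 0# (map f xs)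

  infix 6 sumOver productOver maxOver
  syntax sumOver     xs (λ x → e) = ∑[ x ∈ xs ] e
  syntax productOver xs (λ x → e) = ∏[ x ∈ xs ] e
  syntax maxOver     xs (λ x → e) = max[ x ∈ xs ] e

  open NaturalChoice ≤-totalOrder public using (_⊔_)

-- The functions x ↦ 2^x and log₂.  The first three laws determine x ↦ 2^x
-- uniquely (a monotone homomorphism from (ℝ,+) to (ℝ,·) is determined by
-- its value at 1), and the last one then determines log₂ on the positive
-- reals.  Nothing is assumed about log₂ 0, so a statement quantified over
-- this record covers arbitrarily large negative values of log₂ 0, as the
-- convention log₂ 0 = -∞ demands.

record BinaryExponential (ℛ : CompleteOrderedField) : Set where
  open CompleteOrderedField ℛ
  infix 9 2^_
  field
    2^_       : ℝ → ℝ
    2^-+      : ∀ x y → 2^ (x + y) ≈ 2^ x * 2^ y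
    2^-1      : 2^ 1# ≈ 1# + 1#
    2^-mono-≤ : ∀ {x y} → x ≤ y → 2^ x ≤ 2^ y
    log₂      : ℝ → ℝ
    log₂-cong : ∀ {x y} → x ≈ y → log₂ x ≈ log₂ y
    2^-log₂   : ∀ {x} → 0# < x → 2^ (log₂ x) ≈ x

elements : ∀ {n} → Subset n → List (Fin n)
elements S = filter (_∈? S) (allFin _)

-- A finite set of subsets of Fin n.
record Family (n : ℕ) : Set where
  field
    members : List (Subset n)
    unique  : Unique members

open Family public

infix 4 _∈ᶠ_
_∈ᶠ_ : ∀ {n} → Subset n → Family n → Set
S ∈ᶠ 𝒮 = S List.∈ members 𝒮

------------------------------------------------------------------------
-- The multi-digraph D, with Ω = Fin n and F indexed by Fin m

-- actions i σ is meaningful only for σ ∈ flaw i.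
record FlawDigraph (n m : ℕ) : Set where
  field
    flaw             : Fin m → Subset n
    flaw-nonempty    : ∀ i → Nonempty (flaw i)
    actions          : Fin m → Fin n → Subset n
    actions-nonempty : ∀ {i σ} → σ ∈ flaw i → Nonempty (actions i σ)
    actions-≢-self   : ∀ {i σ} → σ ∈ flaw i → actions i σ ≢ ⁅ σ ⁆

  State Flaw : Set
  State = Fin n
  Flaw  = Fin m

  U : State → Subset m
  U σ = tabulate (λ i → lookup (flaw i) σ)

  Arc : Flaw → State → State → Set
  Arc i σ τ = σ ∈ flaw i × τ ∈ actions i σ

  arc? : ∀ i σ τ → Dec (Arc i σ τ)
  arc? i σ τ = (σ ∈? flaw i) ×-dec (τ ∈? actions i σ)

  Sink : State → Set
  Sink σ = ∀ i τ → ¬ Arc i σ τ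

  sink? : Decidable Sink
  sink? σ = Fin.all? λ i → Fin.all? λ τ → ¬? (arc? i σ τ)

  -- b_i^τ and b_i
  inDegree : Flaw → State → ℕ
  inDegree i τ = length (filter (λ σ → arc? i σ τ) (allFin n))

  b : Flaw → ℕ
  b i = ℕExtrema.max 0 (map (inDegree i) (allFin n))

  Atomic : Set
  Atomic = ∀ i → b i ≡ 1

  infixl 5 _⟶[_]_
  data Trajectory : Set where
    start   : State → Trajectory
    _⟶[_]_ : Trajectory → Flaw → State → Trajectory

  last : Trajectory → State
  last (start σ)      = σ
  last (_ ⟶[ _ ] τ) = τ

  addressed : Trajectory → List Flaw
  addressed (start σ)      = []
  addressed (h ⟶[ i ] τ) = addressed h ∷ʳ i

-- The proof that the current state is not a sink is irrelevant, so the
-- choice depends on the trajectory only.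
record FlawChoice {n m : ℕ} (D : FlawDigraph n m) : Set where
  open FlawDigraph D
  field
    choose         : (h : Trajectory) → .(¬ Sink (last h)) → Flaw
    choose-present : (h : Trajectory) (ns : ¬ Sink (last h)) →
                     choose h ns ∈ U (last h)

------------------------------------------------------------------------
-- Unordered labelled rooted forests

-- Trees and forests are represented with an ordering of siblings;
-- unordered forests are the classes of _≅_, which permutes siblings at
-- every level.

data Tree (A : Set) : Set where
  node : A → List (Tree A) → Tree A

Forest : Set → Set
Forest A = List (Tree A)

data _≅ᵗ_ {A : Set} : Rel (Tree A) 0ℓ where
  node : ∀ {a ts us} → Permutation _≅ᵗ_ ts us → node a ts ≅ᵗ node a us

_≅_ : {A : Set} → Rel (Forest A) 0ℓ
_≅_ = Permutation _≅ᵗ_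

module _ {A : Set} where

  label : Tree A → A
  label (node a _) = a

  mutual
    treeLabels : Tree A → List A
    treeLabels (node a ts) = a ∷ labels ts

    -- One entry for each vertex.
    labels : Forest A → List A
    labels []       = []
    labels (t ∷ ts) = treeLabels t ++ labels ts

labelSet : ∀ {m} → Forest (Fin m) → Subset m
labelSet ts = ⋃ (map (⁅_⁆ ∘ label) ts)

DistinctlyLabelledBy : ∀ {m} → Family m → Forest (Fin m) → Set
DistinctlyLabelledBy 𝒮 ts = Unique (map label ts) × labelSet ts ∈ᶠ 𝒮

data ChildrenFrom {m : ℕ} (𝓛 : Fin m → Family m) : Tree (Fin m) → Set where
  node : ∀ {i ts} → DistinctlyLabelledBy (𝓛 i) ts → All (ChildrenFrom 𝓛) ts →
         ChildrenFrom 𝓛 (node i ts)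

-- Properties (1)–(4) of the forest associated with a witness sequence w.
-- By the first one, the forest has exactly length w vertices.
record IsWitnessForest {m : ℕ} (Roots : Family m) (𝓛 : Fin m → Family m)
                       (w : List (Fin m)) (F : Forest (Fin m)) : Set where
  field
    labels-↭ : labels F ↭ w
    roots    : DistinctlyLabelledBy Roots F
    children : All (ChildrenFrom 𝓛) F

------------------------------------------------------------------------
-- Probabilities

module Probability (ℛ : CompleteOrderedField) where
  open CompleteOrderedField ℛ

  IsDistribution : ∀ {n} → (Fin n → ℝ) → Set
  IsDistribution p = (∀ σ → 0# ≤ p σ) × ∑[ σ ∈ allFin _ ] p σ ≈ 1#

  measure : ∀ {n} → (Fin n → ℝ) → Subset n → ℝ
  measure μ S = ∑[ σ ∈ elements S ] μ σ

  module _ {n m : ℕ} (D : FlawDigraph n m) where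
    open FlawDigraph D

    -- ρ i σ τ is meaningful only for σ ∈ flaw i.
    record IsTransition (ρ : Flaw → State → State → ℝ) : Set where
      field
        nonNegative : ∀ {i σ} → σ ∈ flaw i → ∀ τ → 0# ≤ ρ i σ τ
        total       : ∀ {i σ} → σ ∈ flaw i → ∑[ τ ∈ elements (actions i σ) ] ρ i σ τ ≈ 1#
        support     : ∀ {i σ} → σ ∈ flaw i → ∀ {τ} → τ ∉ actions i σ → ρ i σ τ ≈ 0#

  module Walk {n m : ℕ} (D : FlawDigraph n m)
              (ρ : Fin m → Fin n → Fin n → ℝ) (θ : Fin n → ℝ)
              (𝒜 : FlawChoice D) where
    open FlawDigraph D
    open FlawChoice 𝒜

    -- The possible one-step continuations of a trajectory, weighted by
    -- probability; p is the probability of h.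
    advance : Trajectory × ℝ → List (Trajectory × ℝ)
    advance (h , p) with sink? (last h)
    ... | yes _  = (h , p) ∷ []
    ... | no  ns = map (λ τ → h ⟶[ i ] τ , p * ρ i (last h) τ)
                       (elements (actions i (last h)))
      where i = choose h ns

    -- The law of the trajectory of the walk, stopped at a sink or after
    -- k steps, whichever comes first.
    law : ℕ → List (Trajectory × ℝ)
    law zero    = map (λ σ → start σ , θ σ) (allFin n)
    law (suc k) = concatMap advance (law k)

    probSinkWithin : ℕ → ℝ
    probSinkWithin k = ∑[ hp ∈ filter (λ hp → sink? (last (proj₁ hp))) (law k) ] proj₂ hp

    -- w ∈ 𝒲_t, where a trajectory can occur if its probability is
    -- positive (zero-probability arcs of D are allowed).  The length condition excludes trajectories that stop in
    -- fewer than t steps.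
    𝒲 : ℕ → List Flaw → Set
    𝒲 t w = ∃[ h ] ∃[ p ] (h , p) List.∈ law t × 0# < p × addressed h ≡ w × length w ≡ t

    -- The flaw choice is traceable, with the given Roots(θ) and List(f_i).
    -- The map to forests is total; its values outside 𝒲 t are irrelevant.
    Traceable : Family m → (Flaw → Family m) → Set
    Traceable Roots 𝓛 = ∀ t → 1 ℕ.≤ t →
      Σ[ φ ∈ (List Flaw → Forest Flaw) ]
        (∀ {w} → 𝒲 t w → IsWitnessForest Roots 𝓛 w (φ w)) ×
        (∀ {w w′} → 𝒲 t w → 𝒲 t w′ → φ w ≅ φ w′ → w ≡ w′)

  module Charges {n m : ℕ} (D : FlawDigraph n m)
                 (ρ : Fin m → Fin n → Fin n → ℝ) (θ μ : Fin n → ℝ) where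
    open FlawDigraph D

    RegeneratesAt : Flaw → Set
    RegeneratesAt i = ∀ τ →
      1# / measure μ (flaw i) * (∑[ σ ∈ elements (flaw i) ] (μ σ * ρ i σ τ)) ≈ μ τ

    Regenerative : Set
    Regenerative = (∀ i → RegeneratesAt i) × ((∀ σ → θ σ ≈ μ σ) ⊎ Atomic)

    regenerative? : Dec Regenerative
    regenerative? =
      Fin.all? (λ i → Fin.all? λ τ → _ ≈? _)
        ×-dec (Fin.all? (λ σ → θ σ ≈? μ σ) ⊎-dec Fin.all? (λ i → b i ℕ.≟ 1))

    -- λ_i^σ
    distortion : Flaw → State → ℝ
    distortion i σ = max[ τ ∈ elements (actions i σ) ] (ρ i σ τ * (μ σ / μ τ))

    γ : Flaw → ℝ
    γ i = if does regenerative?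
          then measure μ (flaw i)
          else fromℕ (b i) * (max[ σ ∈ elements (flaw i) ] distortion i σ)

{-# OPTIONS --safe #-}
module Submission where

-- The push-forward of μ restricted to f_i along ρ_i is at most γ_i μ, in both definitions of the charge.  By induction,
-- the law of the last state on the event that the witness sequence is w is therefore at most
-- max(θ/μ) · ∏_{i ∈ w} γ_i · μ.
--
-- If no sink is reached within k steps, the walk makes k + 1 steps, so the probability of this is at most max(θ/μ) times
-- the total γ-weight of the witness forests with k + 1 vertices.  Giving each vertex the weight γ_i/q instead, where
-- ζ_i ≤ q for all i, the trees of height at most d with root label i have total weight at most ψ_i, by induction
-- on d.  Hence the failure probability is at most max(θ/μ) · ∑_{S ∈ Roots} ∏_{j ∈ S} ψ_j · q^(k+1) = 2^T₀ q^(k+1),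
-- and q = 1 - u ≤ 2^(-u) for u ∈ [0,1].

open import Defs
open import Algebra.Bundles using (CommutativeRing; Semiring)
import Algebra.Construct.NaturalChoice.Max as NaturalChoice
import Algebra.Definitions.RawSemiring as RawSemiring
import Algebra.Solver.Ring.NaturalCoefficients.Default as SemiringSolver
open import Data.Bool.Base using (if_then_else_)
open import Data.Fin.Base using (Fin)
import Data.Fin.Properties as Fin
open import Data.Fin.Subset using (Subset; _∈_; ⁅_⁆)
open import Data.Fin.Subset.Properties using (_∈?_; x∈⁅x⁆; x∈⁅y⁆⇒x≡y; x∈p∪q⁺; x∈p∪q⁻; ∉⊥)
open import Data.List.Base
  using ( List; []; _∷_; [_]; _++_; _∷ʳ_; map; filter; concatMap; cartesianProductWith; allFin; length
        ; deduplicate; initLast; _∷ʳ′_)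
import Data.List.Extrema as Extrema
import Data.List.Extrema.Nat as ℕExtrema
open import Data.List.Membership.Propositional using () renaming (_∈_ to _∈ˡ_)
open import Data.List.Membership.Propositional.Properties
  using ( ∈-map⁺; ∈-map⁻; ∈-filter⁺; ∈-filter⁻; ∈-allFin; ∈-cartesianProductWith⁺; ∈-concatMap⁺; ∈-∃++
        ; ∈-++⁺ˡ; ∈-++⁺ʳ; ∈-++⁻; ∈-deduplicate⁺; ∈-deduplicate⁻)
open import Data.List.Membership.Propositional.Properties.WithK using (unique∧set⇒bag)
open import Data.List.Properties using (≡-dec; length-++; ∷ʳ-injective)
open import Data.List.Relation.Binary.BagAndSetEquality using (∼bag⇒↭)
import Data.List.Relation.Binary.Permutation.Homogeneous as Homogeneous
open import Data.List.Relation.Binary.Permutation.Propositional as Perm using (_↭_; prep; swap; ↭-sym; ↭⇒↭ₛ)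
open import Data.List.Relation.Binary.Permutation.Propositional.Properties
  using (↭-map-inv; ↭-length; All-resp-↭; shift; shifts; ++⁺)
open import Data.List.Relation.Binary.Pointwise.Base using (Pointwise; []; _∷_)
open import Data.List.Relation.Unary.All as All using (All; []; _∷_)
import Data.List.Relation.Unary.All.Properties as All
open import Data.List.Relation.Unary.AllPairs using (_∷_)
open import Data.List.Relation.Unary.Any as Any using (here; there)
open import Data.List.Relation.Unary.Unique.Propositional using (Unique)
import Data.List.Relation.Unary.Unique.DecPropositional.Properties as Unique
open import Data.List.Relation.Unary.Unique.Propositional.Properties using (allFin⁺; filter⁺)
open import Data.Nat.Base as ℕ using (ℕ; zero; suc; z≤n; s≤s)
import Data.Nat.Properties as ℕ
open import Data.Product.Base using (_×_; _,_; proj₁; proj₂; ∃-syntax)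
open import Data.Sum.Base using (inj₁; inj₂)
open import Data.Vec.Properties using (lookup∘tabulate; []=⇒lookup; lookup⇒[]=)
open import Function.Base using (_∘_)
open import Function.Bundles using (mk⇔)
open import Level using (0ℓ)
open import Relation.Binary.Bundles using (TotalOrder)
import Relation.Binary.Construct.NonStrictToStrict as NonStrictToStrict
open import Relation.Binary.Core using (_⇒_)
open import Relation.Binary.Definitions using (DecidableEquality; Reflexive; Symmetric)
open import Relation.Binary.PropositionalEquality.Core as ≡ using (_≡_)
import Relation.Binary.Reasoning.PartialOrder as PartialOrderReasoning
open import Relation.Binary.Structures using (IsDecTotalOrder)
open import Relation.Nullary using (¬_; Dec; yes; no; contradiction)
open import Relation.Nullary.Decidable using (does; ¬?; _×-dec_)
open import Relation.Unary using (Pred; Decidable)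

-- The flaw addressed may depend on the whole history, so the walk is no Markov chain. Fixing the
-- witness sequence w removes this obstacle: on that event the flaw of every step is known, and
-- whatever the mechanism does elsewhere only lowers the probability of the event. The bound on the
-- law of the last state is carried in dual form, as a bound on expectations of arbitrary
-- non-negative functions f, because one more step of the walk then simply replaces f by another
-- such function. Traceability is injective only up to isomorphism of forests. To compare sums, each
-- isomorphism class gets a representative in an explicit finite list, and a witness sequence is
-- related to the representative of its forest. The weights γ_i/q require q > 0, whereas all ζ_i may
-- vanish. With x the real bound on the number of steps, u = xδ/(k + 1) is below 1 because x < k +
-- 1, and yet (k + 1)u = xδ is still at least T₀ + s. Of the exponential only the homomorphism law,
-- monotonicity and its value at 1 are given, so the comparison of 1 - u with 2^(-u) has to come
-- from completeness.

module OrderedField (ℛ : CompleteOrderedField) where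
  open CompleteOrderedField ℛ
  open CommutativeRing commutativeRing public
    using ( +-cong; +-congˡ; +-congʳ; +-assoc; +-comm; +-identityˡ; +-identityʳ
          ; -‿inverseˡ; -‿inverseʳ; *-cong; *-congˡ; *-congʳ; *-assoc; *-comm
          ; *-identityˡ; *-identityʳ; distribˡ; distribʳ; zeroˡ; zeroʳ)
    renaming (refl to ≈-refl; sym to ≈-sym; trans to ≈-trans)
  open IsDecTotalOrder isDecTotalOrder public using ()
    renaming ( refl to ≤-refl; reflexive to ≤-reflexive; trans to ≤-trans
             ; antisym to ≤-antisym; total to ≤-total)

  open RawSemiring (Semiring.rawSemiring (CommutativeRing.semiring commutativeRing)) public using (_^_)

  module Solver = SemiringSolver (CommutativeRing.commutativeSemiring commutativeRing)
  module ≤-Reasoning = PartialOrderReasoning (TotalOrder.poset ≤-totalOrder)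
  open NaturalChoice ≤-totalOrder public using (x≤x⊔y; x≤y⊔x)
  open Solver using (solve; _:=_; _:+_; _:*_; con)
  open ≤-Reasoning

  private variable
    A B : Set
    x y z u v : ℝ

  -- Order and arithmetic of the reals

  ≰⇒> : ¬ x ≤ y → y < x
  ≰⇒> = NonStrictToStrict.≰⇒> _≈_ _≤_ ≈-sym ≤-reflexive ≤-total

  infix 4 _<?_
  _<?_ : (x y : ℝ) → Dec (x < y)
  _<?_ = NonStrictToStrict.<-decidable _≈_ _≤_ _≈?_ _≤?_

  ≮⇒≥ : ¬ x < y → y ≤ x
  ≮⇒≥ {x} {y} x≮y with y ≤? x
  ... | yes y≤x = y≤x
  ... | no  y≰x = contradiction (≰⇒> y≰x) x≮y

  x-y+y≈x : ∀ x y → x - y + y ≈ x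
  x-y+y≈x x y = ≈-trans (+-assoc x (- y) y) (≈-trans (+-congˡ (-‿inverseˡ y)) (+-identityʳ x))

  +-mono-≤ : x ≤ y → u ≤ v → x + u ≤ y + v
  +-mono-≤ {x} {y} {u} {v} x≤y u≤v = begin
    x + u ≤⟨ +-monoˡ-≤ u x≤y ⟩
    y + u ≈⟨ +-comm y u ⟩
    u + y ≤⟨ +-monoˡ-≤ y u≤v ⟩
    v + y ≈⟨ +-comm v y ⟩
    y + v ∎

  +-cancelʳ-≤ : ∀ z → x + z ≤ y + z → x ≤ y
  +-cancelʳ-≤ {x} {y} z x+z≤y+z = begin
    x             ≈⟨ cancel x ⟨
    x + z + (- z) ≤⟨ +-monoˡ-≤ (- z) x+z≤y+z ⟩
    y + z + (- z) ≈⟨ cancel y ⟩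
    y             ∎
    where
    cancel : ∀ x → x + z + (- z) ≈ x
    cancel x = ≈-trans (+-assoc x z (- z)) (≈-trans (+-congˡ (-‿inverseʳ z)) (+-identityʳ x))

  x+z≤y⇒x≤y-z : ∀ z → x + z ≤ y → x ≤ y - z
  x+z≤y⇒x≤y-z z x+z≤y = +-cancelʳ-≤ z (≤-trans x+z≤y (≤-reflexive (≈-sym (x-y+y≈x _ z))))

  x≤y⇒0≤y-x : x ≤ y → 0# ≤ y - x
  x≤y⇒0≤y-x x≤y = x+z≤y⇒x≤y-z _ (≤-trans (≤-reflexive (+-identityˡ _)) x≤y)

  x≤x+y : 0# ≤ y → x ≤ x + y
  x≤x+y {y} {x} 0≤y = ≤-trans (≤-reflexive (≈-sym (+-identityʳ x))) (+-mono-≤ ≤-refl 0≤y)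

  x≤y+x : 0# ≤ y → x ≤ y + x
  x≤y+x 0≤y = ≤-trans (x≤x+y 0≤y) (≤-reflexive (+-comm _ _))

  +-nonNegative : 0# ≤ x → 0# ≤ y → 0# ≤ x + y
  +-nonNegative 0≤x 0≤y = ≤-trans 0≤x (x≤x+y 0≤y)

  *-monoʳ-≤ : 0# ≤ z → x ≤ y → z * x ≤ z * y
  *-monoʳ-≤ {z} {x} {y} 0≤z x≤y = begin
    z * x                 ≤⟨ x≤y+x (*-nonNegative 0≤z (x≤y⇒0≤y-x x≤y)) ⟩
    z * (y - x) + z * x   ≈⟨ distribˡ z (y - x) x ⟨
    z * (y - x + x)       ≈⟨ *-congˡ (x-y+y≈x y x) ⟩
    z * y                 ∎

  *-monoˡ-≤ : 0# ≤ z → x ≤ y → x * z ≤ y * z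
  *-monoˡ-≤ {z} {x} {y} 0≤z x≤y = begin
    x * z ≈⟨ *-comm x z ⟩
    z * x ≤⟨ *-monoʳ-≤ 0≤z x≤y ⟩
    z * y ≈⟨ *-comm z y ⟩
    y * z ∎

  *-mono-≤ : 0# ≤ x → 0# ≤ v → x ≤ y → u ≤ v → x * u ≤ y * v
  *-mono-≤ 0≤x 0≤v x≤y u≤v = ≤-trans (*-monoʳ-≤ 0≤x u≤v) (*-monoˡ-≤ 0≤v x≤y)

  0≤x² : ∀ x → 0# ≤ x * x
  0≤x² x with ≤-total 0# x
  ... | inj₁ 0≤x = *-nonNegative 0≤x 0≤x
  ... | inj₂ x≤0 = begin
    0#                          ≤⟨ *-nonNegative 0≤-x 0≤-x ⟩
    - x * - x                   ≈⟨ +-identityʳ _ ⟨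
    -- With y = - x, the identity y² + (x + y)x = (x + y)y + x² is free of subtraction, and both
    -- terms containing x + y vanish.
    - x * - x + 0#              ≈⟨ +-congˡ (zeroˡ x) ⟨
    - x * - x + 0# * x          ≈⟨ +-congˡ (*-congʳ (-‿inverseʳ x)) ⟨
    - x * - x + (x + - x) * x   ≈⟨ solve 2 (λ x y → y :* y :+ (x :+ y) :* x := (x :+ y) :* y :+ x :* x) ≈-refl x (- x) ⟩
    (x + - x) * - x + x * x     ≈⟨ +-congʳ (*-congʳ (-‿inverseʳ x)) ⟩
    0# * - x + x * x            ≈⟨ +-congʳ (zeroˡ (- x)) ⟩
    0# + x * x                  ≈⟨ +-identityˡ _ ⟩
    x * x                       ∎
    where
    0≤-x : 0# ≤ - x
    0≤-x = ≤-trans (x≤y⇒0≤y-x x≤0) (≤-reflexive (+-identityˡ (- x)))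

  0≤1 : 0# ≤ 1#
  0≤1 = ≤-trans (0≤x² 1#) (≤-reflexive (*-identityˡ 1#))

  0<1 : 0# < 1#
  0<1 = 0≤1 , 0≉1

  <-≤-trans : x < y → y ≤ z → x < z
  <-≤-trans = NonStrictToStrict.<-≤-trans _≈_ _≤_ ≈-sym ≤-trans ≤-antisym (λ e → ≤-respʳ e)
    where
    ≤-respʳ : ∀ {x y z} → x ≈ y → z ≤ x → z ≤ y
    ≤-respʳ e z≤x = ≤-trans z≤x (≤-reflexive e)

  x<y⇒0<y-x : x < y → 0# < y - x
  x<y⇒0<y-x {x} {y} (x≤y , x≉y) = x≤y⇒0≤y-x x≤y , λ 0≈y-x → x≉y (begin-equality
    x         ≈⟨ +-identityˡ x ⟨
    0# + x    ≈⟨ +-congʳ 0≈y-x ⟩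
    y - x + x ≈⟨ x-y+y≈x y x ⟩
    y         ∎)

  fromℕ-nonNegative : ∀ k → 0# ≤ fromℕ k
  fromℕ-nonNegative zero    = ≤-refl
  fromℕ-nonNegative (suc k) = +-nonNegative 0≤1 (fromℕ-nonNegative k)

  fromℕ-mono : ∀ {k l} → k ℕ.≤ l → fromℕ k ≤ fromℕ l
  fromℕ-mono {l = l} ℕ.z≤n = fromℕ-nonNegative l
  fromℕ-mono (ℕ.s≤s k≤l) = +-mono-≤ ≤-refl (fromℕ-mono k≤l)

  ^-nonNegative : 0# ≤ x → ∀ k → 0# ≤ x ^ k
  ^-nonNegative 0≤x zero    = 0≤1
  ^-nonNegative 0≤x (suc k) = *-nonNegative 0≤x (^-nonNegative 0≤x k)

  *-inverseʳ : 0# < x → x * x ⁻¹ ≈ 1#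
  *-inverseʳ (_ , 0≉x) = ⁻¹-inverse (0≉x ∘ ≈-sym)

  *-inverseˡ : 0# < x → x ⁻¹ * x ≈ 1#
  *-inverseˡ 0<x = ≈-trans (*-comm _ _) (*-inverseʳ 0<x)

  x/y*y≈x : ∀ x → 0# < y → x / y * y ≈ x
  x/y*y≈x x 0<y = ≈-trans (*-assoc x _ _) (≈-trans (*-congˡ (*-inverseˡ 0<y)) (*-identityʳ x))

  ⁻¹-nonNegative : 0# < x → 0# ≤ x ⁻¹
  ⁻¹-nonNegative {x} 0<x with ≤-total 0# (x ⁻¹)
  ... | inj₁ 0≤x⁻¹ = 0≤x⁻¹
  ... | inj₂ x⁻¹≤0 = contradiction (≤-antisym 0≤1 1≤0) 0≉1
    where
    1≤0 : 1# ≤ 0#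
    1≤0 = begin
      1#       ≈⟨ *-inverseʳ 0<x ⟨
      x * x ⁻¹ ≤⟨ *-monoʳ-≤ (proj₁ 0<x) x⁻¹≤0 ⟩
      x * 0#   ≈⟨ zeroʳ x ⟩
      0#       ∎

  *-cancelʳ-≤ : 0# < z → x * z ≤ y * z → x ≤ y
  *-cancelʳ-≤ {z} {x} {y} 0<z xz≤yz = begin
    x             ≈⟨ cancel x ⟨
    x * z * z ⁻¹  ≤⟨ *-monoˡ-≤ (⁻¹-nonNegative 0<z) xz≤yz ⟩
    y * z * z ⁻¹  ≈⟨ cancel y ⟩
    y             ∎
    where
    cancel : ∀ x → x * z * z ⁻¹ ≈ x
    cancel x = ≈-trans (*-assoc x z _) (≈-trans (*-congˡ (*-inverseʳ 0<z)) (*-identityʳ x))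

  x≤y*z⇒x/z≤y : 0# < z → x ≤ y * z → x / z ≤ y
  x≤y*z⇒x/z≤y {z} {x} 0<z x≤yz = *-cancelʳ-≤ 0<z (≤-trans (≤-reflexive (x/y*y≈x x 0<z)) x≤yz)

  x/z≤y⇒x≤y*z : 0# < z → x / z ≤ y → x ≤ y * z
  x/z≤y⇒x≤y*z {z} {x} 0<z x/z≤y = ≤-trans (≤-reflexive (≈-sym (x/y*y≈x x 0<z))) (*-monoˡ-≤ (proj₁ 0<z) x/z≤y)

  -- Multiplication by the indicator of P. Sums over events become sums over one fixed list, which
  -- can be compared termwise and interchanged.
  when : {P : Set} → Dec P → ℝ → ℝ
  when (yes _) x = x
  when (no _)  x = 0#

  when-true : {P : Set} (P? : Dec P) → P → when P? x ≈ x
  when-true (yes _) p = ≈-refl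
  when-true (no ¬p) p = contradiction p ¬p

  when-false : {P : Set} (P? : Dec P) → ¬ P → when P? x ≈ 0#
  when-false (yes p) ¬p = contradiction p ¬p
  when-false (no _)  ¬p = ≈-refl

  when-nonNegative : {P : Set} (P? : Dec P) → 0# ≤ x → 0# ≤ when P? x
  when-nonNegative (yes _) 0≤x = 0≤x
  when-nonNegative (no _)  0≤x = ≤-refl

  when-*ˡ : {P : Set} (P? : Dec P) → ∀ z → z * when P? x ≈ when P? (z * x)
  when-*ˡ (yes _) z = ≈-refl
  when-*ˡ (no _)  z = zeroʳ z

  when-≤ : {P : Set} (P? : Dec P) → 0# ≤ x → when P? x ≤ x
  when-≤ (yes _) 0≤x = ≤-refl
  when-≤ (no _)  0≤x = 0≤x

  when-complement : {P : Set} (P? : Dec P) → when P? x + when (¬? P?) x ≈ x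
  when-complement (yes _) = +-identityʳ _
  when-complement (no _)  = +-identityˡ _

  -- Finite sums, products and maxima

  sum-mono-∈ : {f g : A → ℝ} (xs : List A) → (∀ {a} → a ∈ˡ xs → f a ≤ g a) → sumOver xs f ≤ sumOver xs g
  sum-mono-∈ []       f≤g = ≤-refl
  sum-mono-∈ (x ∷ xs) f≤g = +-mono-≤ (f≤g (here ≡.refl)) (sum-mono-∈ xs (f≤g ∘ there))

  sum-mono : {f g : A → ℝ} (xs : List A) → (∀ a → f a ≤ g a) → sumOver xs f ≤ sumOver xs g
  sum-mono xs f≤g = sum-mono-∈ xs (λ {a} _ → f≤g a)

  sum-cong : {f g : A → ℝ} (xs : List A) → (∀ a → f a ≈ g a) → sumOver xs f ≈ sumOver xs g
  sum-cong []       f≈g = ≈-refl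
  sum-cong (x ∷ xs) f≈g = +-cong (f≈g x) (sum-cong xs f≈g)

  sum-zero : {f : A → ℝ} (xs : List A) → (∀ a → f a ≈ 0#) → sumOver xs f ≈ 0#
  sum-zero []       f≈0 = ≈-refl
  sum-zero (x ∷ xs) f≈0 = ≈-trans (+-cong (f≈0 x) (sum-zero xs f≈0)) (+-identityˡ 0#)

  sum-nonNegative-∈ : {f : A → ℝ} (xs : List A) → (∀ {a} → a ∈ˡ xs → 0# ≤ f a) → 0# ≤ sumOver xs f
  sum-nonNegative-∈ []       0≤f = ≤-refl
  sum-nonNegative-∈ (x ∷ xs) 0≤f = +-nonNegative (0≤f (here ≡.refl)) (sum-nonNegative-∈ xs (0≤f ∘ there))

  sum-nonNegative : {f : A → ℝ} (xs : List A) → (∀ a → 0# ≤ f a) → 0# ≤ sumOver xs f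
  sum-nonNegative xs 0≤f = sum-nonNegative-∈ xs (λ {a} _ → 0≤f a)

  term≤sum : {f : A → ℝ} {xs : List A} → (∀ {a} → a ∈ˡ xs → 0# ≤ f a) → ∀ {a} → a ∈ˡ xs → f a ≤ sumOver xs f
  term≤sum 0≤f (here ≡.refl) = x≤x+y (sum-nonNegative-∈ _ (0≤f ∘ there))
  term≤sum 0≤f (there a∈xs)  = ≤-trans (term≤sum (0≤f ∘ there) a∈xs) (x≤y+x (0≤f (here ≡.refl)))

  sum-++ : (f : A → ℝ) (xs ys : List A) → sumOver (xs ++ ys) f ≈ sumOver xs f + sumOver ys f
  sum-++ f []       ys = ≈-sym (+-identityˡ _)
  sum-++ f (x ∷ xs) ys = ≈-trans (+-congˡ (sum-++ f xs ys)) (≈-sym (+-assoc _ _ _))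

  sum-map : (f : B → ℝ) (g : A → B) (xs : List A) → sumOver (map g xs) f ≈ sumOver xs (f ∘ g)
  sum-map f g []       = ≈-refl
  sum-map f g (x ∷ xs) = +-congˡ (sum-map f g xs)

  sum-concatMap : (f : B → ℝ) (g : A → List B) (xs : List A) →
                  sumOver (concatMap g xs) f ≈ ∑[ a ∈ xs ] sumOver (g a) f
  sum-concatMap f g []       = ≈-refl
  sum-concatMap f g (x ∷ xs) = ≈-trans (sum-++ f (g x) _) (+-congˡ (sum-concatMap f g xs))

  sum-+ : (f g : A → ℝ) (xs : List A) → ∑[ a ∈ xs ] (f a + g a) ≈ sumOver xs f + sumOver xs g
  sum-+ f g []       = ≈-sym (+-identityˡ 0#)
  sum-+ f g (x ∷ xs) = ≈-trans (+-congˡ (sum-+ f g xs))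
    (solve 4 (λ a b c d → (a :+ b) :+ (c :+ d) := (a :+ c) :+ (b :+ d)) ≈-refl _ _ _ _)

  sum-*ˡ : ∀ c (f : A → ℝ) (xs : List A) → ∑[ a ∈ xs ] (c * f a) ≈ c * sumOver xs f
  sum-*ˡ c f []       = ≈-sym (zeroʳ c)
  sum-*ˡ c f (x ∷ xs) = ≈-trans (+-congˡ (sum-*ˡ c f xs)) (≈-sym (distribˡ c _ _))

  sum-*ʳ : ∀ c (f : A → ℝ) (xs : List A) → ∑[ a ∈ xs ] (f a * c) ≈ sumOver xs f * c
  sum-*ʳ c f xs = ≈-trans (sum-cong xs (λ a → *-comm (f a) c)) (≈-trans (sum-*ˡ c f xs) (*-comm c _))

  sum-swap : (f : A → B → ℝ) (xs : List A) (ys : List B) →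
             (∑[ a ∈ xs ] ∑[ b ∈ ys ] f a b) ≈ ∑[ b ∈ ys ] ∑[ a ∈ xs ] f a b
  sum-swap f []       ys = ≈-sym (sum-zero ys (λ _ → ≈-refl))
  sum-swap f (x ∷ xs) ys = ≈-trans (+-congˡ (sum-swap f xs ys)) (≈-sym (sum-+ (f x) _ ys))

  sum-filter : {P : Pred A 0ℓ} (P? : Decidable P) (f : A → ℝ) (xs : List A) →
               sumOver (filter P? xs) f ≈ ∑[ a ∈ xs ] when (P? a) (f a)
  sum-filter P? f []       = ≈-refl
  sum-filter P? f (x ∷ xs) with P? x
  ... | yes _ = +-congˡ (sum-filter P? f xs)
  ... | no  _ = ≈-trans (sum-filter P? f xs) (≈-sym (+-identityˡ _))

  sum-filter-≤ : {P : Pred A 0ℓ} (P? : Decidable P) {f : A → ℝ} (xs : List A) → (∀ a → 0# ≤ f a) →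
                 sumOver (filter P? xs) f ≤ sumOver xs f
  sum-filter-≤ P? {f} xs 0≤f = ≤-trans (≤-reflexive (sum-filter P? f xs)) (sum-mono xs (λ a → when-≤ (P? a) (0≤f a)))

  sum-constant : (c : ℝ) (xs : List A) → ∑[ a ∈ xs ] c ≈ fromℕ (length xs) * c
  sum-constant c []       = ≈-sym (zeroˡ c)
  sum-constant c (x ∷ xs) = ≈-trans (+-cong (≈-sym (*-identityˡ c)) (sum-constant c xs)) (≈-sym (distribʳ c 1# _))

  sum-cartesianProductWith : {C : Set} (h : A → B → C) (f : A → ℝ) (g : B → ℝ) (e : C → ℝ) →
    (∀ a b → e (h a b) ≈ f a * g b) → (xs : List A) (ys : List B) →
    sumOver (cartesianProductWith h xs ys) e ≈ sumOver xs f * sumOver ys g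
  sum-cartesianProductWith h f g e eq []       ys = ≈-sym (zeroˡ _)
  sum-cartesianProductWith h f g e eq (x ∷ xs) ys = begin-equality
    sumOver (map (h x) ys ++ cartesianProductWith h xs ys) e
      ≈⟨ sum-++ e (map (h x) ys) _ ⟩
    sumOver (map (h x) ys) e + _
      ≈⟨ +-cong (sum-map e (h x) ys) (sum-cartesianProductWith h f g e eq xs ys) ⟩
    sumOver ys (e ∘ h x) + sumOver xs f * sumOver ys g
      ≈⟨ +-congʳ (≈-trans (sum-cong ys (eq x)) (sum-*ˡ (f x) g ys)) ⟩
    f x * sumOver ys g + sumOver xs f * sumOver ys g
      ≈⟨ distribʳ _ _ _ ⟨
    (f x + sumOver xs f) * sumOver ys g                       ∎

  product-nonNegative : {f : A → ℝ} (xs : List A) → (∀ a → 0# ≤ f a) → 0# ≤ productOver xs f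
  product-nonNegative []       0≤f = 0≤1
  product-nonNegative (x ∷ xs) 0≤f = *-nonNegative (0≤f x) (product-nonNegative xs 0≤f)

  product-mono : {f g : A → ℝ} (xs : List A) → (∀ a → 0# ≤ f a) → (∀ a → f a ≤ g a) →
                 productOver xs f ≤ productOver xs g
  product-mono []       0≤f f≤g = ≤-refl
  product-mono (x ∷ xs) 0≤f f≤g =
    *-mono-≤ (0≤f x) (product-nonNegative xs (λ a → ≤-trans (0≤f a) (f≤g a))) (f≤g x) (product-mono xs 0≤f f≤g)

  product-++ : (f : A → ℝ) (xs ys : List A) → productOver (xs ++ ys) f ≈ productOver xs f * productOver ys f
  product-++ f []       ys = ≈-sym (*-identityˡ _)
  product-++ f (x ∷ xs) ys = ≈-trans (*-congˡ (product-++ f xs ys)) (≈-sym (*-assoc _ _ _))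

  sum-↭ : (f : A → ℝ) {xs ys : List A} → xs ↭ ys → sumOver xs f ≈ sumOver ys f
  sum-↭ f Perm.refl        = ≈-refl
  sum-↭ f (prep x p)       = +-congˡ (sum-↭ f p)
  sum-↭ f (swap x y p)     = ≈-trans (+-congˡ (+-congˡ (sum-↭ f p)))
    (solve 3 (λ a b c → a :+ (b :+ c) := b :+ (a :+ c)) ≈-refl _ _ _)
  sum-↭ f (Perm.trans p q) = ≈-trans (sum-↭ f p) (sum-↭ f q)

  product-↭ : (f : A → ℝ) {xs ys : List A} → xs ↭ ys → productOver xs f ≈ productOver ys f
  product-↭ f Perm.refl        = ≈-refl
  product-↭ f (prep x p)       = *-congˡ (product-↭ f p)
  product-↭ f (swap x y p)     = ≈-trans (*-congˡ (*-congˡ (product-↭ f p)))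
    (solve 3 (λ a b c → a :* (b :* c) := b :* (a :* c)) ≈-refl _ _ _)
  product-↭ f (Perm.trans p q) = ≈-trans (product-↭ f p) (product-↭ f q)

  -- The partner of the head is deleted from `ys`; injectivity of R ensures that no later element
  -- needs the deleted entry. A relation instead of a function is convenient because partners are
  -- known only up to isomorphism.
  sum-injection : (R : A → B → Set) (f : A → ℝ) (g : B → ℝ) → (∀ b → 0# ≤ g b) →
    (∀ {a a′ b} → R a b → R a′ b → a ≡ a′) →
    {xs : List A} → Unique xs → (ys : List B) →
    (∀ {a} → a ∈ˡ xs → ∃[ b ] b ∈ˡ ys × R a b × f a ≤ g b) →
    sumOver xs f ≤ sumOver ys g
  sum-injection R f g 0≤g R-injective {[]}     _          ys total = sum-nonNegative ys 0≤g
  sum-injection R f g 0≤g R-injective {x ∷ xs} (x∉xs ∷ xs!) ys total with total (here ≡.refl)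
  ... | y , y∈ys , xRy , fx≤gy with ∈-∃++ y∈ys
  ...   | as , bs , ≡.refl = begin
    f x + sumOver xs f          ≤⟨ +-mono-≤ fx≤gy (sum-injection R f g 0≤g R-injective xs! (as ++ bs) total′) ⟩
    sumOver (y ∷ as ++ bs) g    ≈⟨ sum-↭ g (↭-sym (shift y as bs)) ⟩
    sumOver (as ++ y ∷ bs) g    ∎
    where
    total′ : ∀ {a} → a ∈ˡ xs → ∃[ b ] b ∈ˡ as ++ bs × R a b × f a ≤ g b
    total′ a∈xs with total (there a∈xs)
    ... | b , b∈ys , aRb , fa≤gb with ∈-++⁻ as b∈ys
    ...   | inj₁ b∈as           = b , ∈-++⁺ˡ b∈as , aRb , fa≤gb
    ...   | inj₂ (there b∈bs)   = b , ∈-++⁺ʳ as b∈bs , aRb , fa≤gb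
    ...   | inj₂ (here ≡.refl)  = contradiction (R-injective xRy aRb) (All.lookup x∉xs a∈xs)

  max-nonNegative : (f : A → ℝ) (xs : List A) → 0# ≤ maxOver xs f
  max-nonNegative f xs = Extrema.⊥≤max ≤-totalOrder 0# (map f xs)

  f≤max : (f : A → ℝ) {xs : List A} {a : A} → a ∈ˡ xs → f a ≤ maxOver xs f
  f≤max f {xs} a∈xs = All.lookup (Extrema.xs≤max ≤-totalOrder 0# (map f xs)) (∈-map⁺ f a∈xs)

  max< : {f : A → ℝ} (xs : List A) → 0# < x → (∀ a → f a < x) → maxOver xs f < x
  max< xs 0<x f<x = Extrema.max<v⁺ ≤-totalOrder 0<x (All.map⁺ (All.universal f<x xs))

-- The inequality between 1 - u and the binary exponential

module Exponential (ℛ : CompleteOrderedField) (E : BinaryExponential ℛ) where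
  open CompleteOrderedField ℛ
  open BinaryExponential E
  open OrderedField ℛ
  open Solver using (solve; _:=_; _:+_; _:*_; con)
  open ≤-Reasoning

  private
    2# : ℝ
    2# = 1# + 1#

    3# : ℝ
    3# = 2# + 1#

  1≤2 : 1# ≤ 2#
  1≤2 = x≤x+y 0≤1

  0<2 : 0# < 2#
  0<2 = <-≤-trans 0<1 1≤2

  0<3 : 0# < 3#
  0<3 = <-≤-trans 0<1 (x≤y+x (proj₁ 0<2))

  2^-cong : ∀ {x y} → x ≈ y → 2^ x ≈ 2^ y
  2^-cong x≈y = ≤-antisym (2^-mono-≤ (≤-reflexive x≈y)) (2^-mono-≤ (≤-reflexive (≈-sym x≈y)))

  2^-0 : 2^ 0# ≈ 1#
  2^-0 = ≤-antisym (*-cancelʳ-≤ 0<2 (≤-reflexive 2^0*2≈1*2)) (*-cancelʳ-≤ 0<2 (≤-reflexive (≈-sym 2^0*2≈1*2)))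
    where
    2^0*2≈1*2 : 2^ 0# * 2# ≈ 1# * 2#
    2^0*2≈1*2 = begin-equality
      2^ 0# * 2#    ≈⟨ *-congˡ 2^-1 ⟨
      2^ 0# * 2^ 1# ≈⟨ 2^-+ 0# 1# ⟨
      2^ (0# + 1#)  ≈⟨ 2^-cong (+-identityˡ 1#) ⟩
      2^ 1#         ≈⟨ 2^-1 ⟩
      2#            ≈⟨ *-identityˡ 2# ⟨
      1# * 2#       ∎

  2^-inverse : ∀ x → 2^ (- x) * 2^ x ≈ 1#
  2^-inverse x = ≈-trans (≈-sym (2^-+ (- x) x)) (≈-trans (2^-cong (-‿inverseˡ x)) 2^-0)

  -- A value of the exponential is the square of its value at half the argument.
  2^-nonNegative : ∀ x → 0# ≤ 2^ x
  2^-nonNegative x = begin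
    0#                          ≤⟨ 0≤x² (2^ (x / 2#)) ⟩
    2^ (x / 2#) * 2^ (x / 2#)   ≈⟨ 2^-+ _ _ ⟨
    2^ (x / 2# + x / 2#)        ≈⟨ 2^-cong (solve 1 (λ y → y :+ y := y :* (con 1 :+ con 1)) ≈-refl (x / 2#)) ⟩
    2^ (x / 2# * 2#)            ≈⟨ 2^-cong (x/y*y≈x x 0<2) ⟩
    2^ x                        ∎

  2^-positive : ∀ x → 0# < 2^ x
  2^-positive x = 2^-nonNegative x , λ 0≈2^x → 0≉1 (begin-equality
    0#              ≈⟨ zeroʳ _ ⟨
    2^ (- x) * 0#   ≈⟨ *-congˡ 0≈2^x ⟩
    2^ (- x) * 2^ x ≈⟨ 2^-inverse x ⟩
    1#              ∎)

  -- The supremum s of the excess of 2^u over its chord 1 + u on [0,1] vanishes: doubling the argument squares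
  -- 2^u, so every excess c satisfies 3c ≤ 2s.
  2^-chord : ∀ {u} → 0# ≤ u → u ≤ 1# → 2^ u ≤ 1# + u
  2^-chord = chord (supremum Excess (0# , 0-excess) (2# , ≤2))
    where
    Excess : ℝ → Set
    Excess c = ∃[ u ] 0# ≤ u × u ≤ 1# × c + (1# + u) ≤ 2^ u

    0-excess : Excess 0#
    0-excess = 0# , ≤-refl , 0≤1 , ≤-reflexive (begin-equality
      0# + (1# + 0#) ≈⟨ solve 0 (con 0 :+ (con 1 :+ con 0) := con 1) ≈-refl ⟩
      1#             ≈⟨ 2^-0 ⟨
      2^ 0#          ∎)

    ≤2 : UpperBound Excess 2#
    ≤2 {c} (u , 0≤u , u≤1 , c≤) = begin
      c              ≤⟨ x≤x+y (+-nonNegative 0≤1 0≤u) ⟩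
      c + (1# + u)   ≤⟨ c≤ ⟩
      2^ u           ≤⟨ 2^-mono-≤ u≤1 ⟩
      2^ 1#          ≈⟨ 2^-1 ⟩
      2#             ∎

    chord : ∃[ s ] UpperBound Excess s × (∀ {u} → UpperBound Excess u → s ≤ u) →
            ∀ {u} → 0# ≤ u → u ≤ 1# → 2^ u ≤ 1# + u
    chord (s , upper , least) 0≤u u≤1 = begin
      2^ _          ≤⟨ 2^≤s+ 0≤u u≤1 ⟩
      s + (1# + _)  ≤⟨ +-monoˡ-≤ _ s≤0 ⟩
      0# + (1# + _) ≈⟨ +-identityˡ _ ⟩
      1# + _        ∎
      where
      0≤s : 0# ≤ s
      0≤s = upper 0-excess

      2^≤s+ : ∀ {u} → 0# ≤ u → u ≤ 1# → 2^ u ≤ s + (1# + u)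
      2^≤s+ {u} 0≤u u≤1 = begin
        2^ u                           ≈⟨ x-y+y≈x (2^ u) (1# + u) ⟨
        2^ u - (1# + u) + (1# + u)     ≤⟨ +-monoˡ-≤ _ (upper (u , 0≤u , u≤1 , ≤-reflexive (x-y+y≈x _ _))) ⟩
        s + (1# + u)                   ∎

      3c≤2s : ∀ {c} → Excess c → c * 3# ≤ s * 2#
      3c≤2s {c} c-excess@(u , 0≤u , u≤1 , c≤) with ≤-total c 0#
      ... | inj₁ c≤0 = begin
        c * 3#  ≤⟨ *-monoˡ-≤ (proj₁ 0<3) c≤0 ⟩
        0# * 3# ≈⟨ zeroˡ 3# ⟩
        0#      ≤⟨ *-nonNegative 0≤s (proj₁ 0<2) ⟩
        s * 2#  ∎
      ... | inj₂ 0≤c with ≤-total (u + u) 1#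
      -- Here 2u is still in [0,1]. Since (c + 1 + u)² = 2c + 1 + 2u + (c + u)² is at most 2^(2u),
      -- which is at most s + 1 + 2u, already 2c ≤ s; adding c ≤ s gives the form shared with the
      -- other case.
      ...   | inj₁ 2u≤1 = +-cancelʳ-≤ (1# + (u + u)) (begin
        c * 3# + (1# + (u + u))
          ≈⟨ solve 2 (λ c u → c :* con 3 :+ (con 1 :+ (u :+ u)) := c :+ (c :+ c :+ (con 1 :+ (u :+ u)))) ≈-refl c u ⟩
        c + (c + c + (1# + (u + u)))
          ≤⟨ +-mono-≤ (upper c-excess) (x≤x+y (0≤x² (c + u))) ⟩
        s + (c + c + (1# + (u + u)) + (c + u) * (c + u))
          ≈⟨ +-congˡ (solve 2 (λ c u → c :+ c :+ (con 1 :+ (u :+ u)) :+ (c :+ u) :* (c :+ u)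
                                        := (c :+ (con 1 :+ u)) :* (c :+ (con 1 :+ u))) ≈-refl c u) ⟩
        s + (c + (1# + u)) * (c + (1# + u))
          ≤⟨ +-mono-≤ ≤-refl square≤ ⟩
        s + 2^ (u + u)
          ≤⟨ +-mono-≤ ≤-refl (2^≤s+ (+-nonNegative 0≤u 0≤u) 2u≤1) ⟩
        s + (s + (1# + (u + u)))
          ≈⟨ solve 2 (λ s u → s :+ (s :+ (con 1 :+ (u :+ u))) := s :* con 2 :+ (con 1 :+ (u :+ u))) ≈-refl s u ⟩
        s * 2# + (1# + (u + u)) ∎)
        where
        square≤ : (c + (1# + u)) * (c + (1# + u)) ≤ 2^ (u + u)
        square≤ = ≤-trans (*-mono-≤ 0≤ (2^-nonNegative u) c≤ c≤) (≤-reflexive (≈-sym (2^-+ u u)))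
          where
          0≤ : 0# ≤ c + (1# + u)
          0≤ = +-nonNegative 0≤c (+-nonNegative 0≤1 0≤u)
      -- Now 2u leaves [0,1], so the bound by s is applied at 2u - 1 and doubled: 2^(2u) is at most
      -- 2s + 4u. On the other side (c + 1 + u)² = c² + 2c + 2cu + (1 - u)² + 4u is at least 3c +
      -- 4u, because 2u is at least 1. This case is the origin of the constant 3.
      ...   | inj₂ 1≤2u = +-cancelʳ-≤ ((u + u) * 2#) (begin
        c * 3# + (u + u) * 2#
          ≈⟨ solve 2 (λ c u → c :* con 3 :+ (u :+ u) :* con 2 := c :+ c :+ c :* con 1 :+ (u :+ u) :* con 2) ≈-refl c u ⟩
        c + c + c * 1# + (u + u) * 2#
          ≤⟨ +-monoˡ-≤ _ (+-mono-≤ ≤-refl (*-monoʳ-≤ 0≤c 1≤2u)) ⟩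
        c + c + c * (u + u) + (u + u) * 2#
          ≤⟨ x≤x+y (+-nonNegative (0≤x² c) (0≤x² w)) ⟩
        c + c + c * (u + u) + (u + u) * 2# + (c * c + w * w)
          -- A factor 1 is exposed to be replaced by w + u. In these variables (1 + u)² = (1 - u)² +
          -- 4u reads (w + 2u)² = w² + 4u(w + u), without subtraction.
          ≈⟨ solve 3 (λ c u w → c :+ c :+ c :* (u :+ u) :+ (u :+ u) :* con 2 :+ (c :* c :+ w :* w)
                                := c :+ c :+ c :* (u :+ u) :+ (u :+ u) :* (con 2 :* con 1) :+ (c :* c :+ w :* w))
               ≈-refl c u w ⟩
        c + c + c * (u + u) + (u + u) * (2# * 1#) + (c * c + w * w)
          ≈⟨ +-congʳ (+-congˡ (*-congˡ (*-congˡ (≈-sym w+u≈1)))) ⟩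
        c + c + c * (u + u) + (u + u) * (2# * (w + u)) + (c * c + w * w)
          ≈⟨ solve 3 (λ c u w → c :+ c :+ c :* (u :+ u) :+ (u :+ u) :* (con 2 :* (w :+ u)) :+ (c :* c :+ w :* w)
                                := (c :* con 1 :+ c :* con 1) :+ c :* (u :+ u) :+ (c :* c :+ (w :+ u :+ u) :* (w :+ u :+ u)))
               ≈-refl c u w ⟩
        (c * 1# + c * 1#) + c * (u + u) + (c * c + (w + u + u) * (w + u + u))
          ≈⟨ +-congˡ (+-congˡ (*-cong (+-congʳ w+u≈1) (+-congʳ w+u≈1))) ⟩
        (c * 1# + c * 1#) + c * (u + u) + (c * c + (1# + u) * (1# + u))
          ≈⟨ solve 2 (λ c u → (c :* con 1 :+ c :* con 1) :+ c :* (u :+ u) :+ (c :* c :+ (con 1 :+ u) :* (con 1 :+ u))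
                              := (c :+ (con 1 :+ u)) :* (c :+ (con 1 :+ u))) ≈-refl c u ⟩
        (c + (1# + u)) * (c + (1# + u))
          ≤⟨ *-mono-≤ (+-nonNegative 0≤c (+-nonNegative 0≤1 0≤u)) (2^-nonNegative u) c≤ c≤ ⟩
        2^ u * 2^ u
          ≈⟨ 2^-+ u u ⟨
        2^ (u + u)
          ≈⟨ 2^-cong (x-y+y≈x (u + u) 1#) ⟨
        2^ (u + u - 1# + 1#)
          ≈⟨ ≈-trans (2^-+ _ 1#) (*-congˡ 2^-1) ⟩
        2^ (u + u - 1#) * 2#
          ≤⟨ *-monoˡ-≤ (proj₁ 0<2) (2^≤s+ (x≤y⇒0≤y-x 1≤2u) 2u-1≤1) ⟩
        (s + (1# + (u + u - 1#))) * 2#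
          ≈⟨ *-congʳ (+-congˡ (≈-trans (+-comm 1# _) (x-y+y≈x (u + u) 1#))) ⟩
        (s + (u + u)) * 2#
          ≈⟨ distribʳ 2# s (u + u) ⟩
        s * 2# + (u + u) * 2# ∎)
        where
        w : ℝ
        w = 1# - u

        w+u≈1 : w + u ≈ 1#
        w+u≈1 = x-y+y≈x 1# u

        2u-1≤1 : u + u - 1# ≤ 1#
        2u-1≤1 = +-cancelʳ-≤ 1# (≤-trans (≤-reflexive (x-y+y≈x (u + u) 1#)) (+-mono-≤ u≤1 u≤1))

      -- By the previous bound 2s/3 is an upper bound of all excesses, so the least one satisfies 3s
      -- ≤ 2s.
      s≤0 : s ≤ 0#
      s≤0 = +-cancelʳ-≤ (s * 2#) (begin
        s + s * 2#  ≈⟨ solve 1 (λ s → s :+ s :* con 2 := s :* con 3) ≈-refl s ⟩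
        s * 3#      ≤⟨ *-monoˡ-≤ (proj₁ 0<3) (least (λ c-excess →
                         *-cancelʳ-≤ 0<3 (≤-trans (3c≤2s c-excess) (≤-reflexive (≈-sym (x/y*y≈x _ 0<3)))))) ⟩
        s * 2# / 3# * 3# ≈⟨ x/y*y≈x _ 0<3 ⟩
        s * 2#      ≈⟨ +-identityˡ _ ⟨
        0# + s * 2# ∎)

  -- The chord bound leaves (1 - u)(1 + u) = 1 - u².
  [1-u]*2^u≤1 : ∀ {u} → 0# ≤ u → u ≤ 1# → (1# - u) * 2^ u ≤ 1#
  [1-u]*2^u≤1 {u} 0≤u u≤1 = begin
    (1# - u) * 2^ u                    ≤⟨ *-monoʳ-≤ (x≤y⇒0≤y-x u≤1) (2^-chord 0≤u u≤1) ⟩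
    (1# - u) * (1# + u)                ≈⟨ *-congˡ (+-congʳ (x-y+y≈x 1# u)) ⟨
    (1# - u) * (1# - u + u + u)        ≤⟨ x≤x+y (0≤x² u) ⟩
    (1# - u) * (1# - u + u + u) + u * u
      ≈⟨ solve 2 (λ w u → w :* (w :+ u :+ u) :+ u :* u := (w :+ u) :* (w :+ u)) ≈-refl (1# - u) u ⟩
    (1# - u + u) * (1# - u + u)        ≈⟨ *-cong (x-y+y≈x 1# u) (x-y+y≈x 1# u) ⟩
    1# * 1#                            ≈⟨ *-identityˡ 1# ⟩
    1#                                 ∎


  [1-u]^k*2^ku≤1 : ∀ {u} → 0# ≤ u → u ≤ 1# → ∀ k → (1# - u) ^ k * 2^ (fromℕ k * u) ≤ 1#
  [1-u]^k*2^ku≤1 {u} 0≤u u≤1 zero = ≤-reflexive (begin-equality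
    1# * 2^ (0# * u) ≈⟨ *-identityˡ _ ⟩
    2^ (0# * u)      ≈⟨ 2^-cong (zeroˡ u) ⟩
    2^ 0#            ≈⟨ 2^-0 ⟩
    1#               ∎)
  [1-u]^k*2^ku≤1 {u} 0≤u u≤1 (suc k) = begin
    q * q ^ k * 2^ ((1# + fromℕ k) * u)
      ≈⟨ *-congˡ (2^-cong (≈-trans (distribʳ u 1# (fromℕ k)) (+-congʳ (*-identityˡ u)))) ⟩
    q * q ^ k * 2^ (u + fromℕ k * u)
      ≈⟨ *-congˡ (2^-+ u (fromℕ k * u)) ⟩
    q * q ^ k * (2^ u * 2^ (fromℕ k * u))
      ≈⟨ solve 4 (λ a b c d → a :* b :* (c :* d) := a :* c :* (b :* d)) ≈-refl _ _ _ _ ⟩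
    q * 2^ u * (q ^ k * 2^ (fromℕ k * u))
      ≤⟨ *-mono-≤ (*-nonNegative 0≤q (2^-nonNegative u)) 0≤1 ([1-u]*2^u≤1 0≤u u≤1) ([1-u]^k*2^ku≤1 0≤u u≤1 k) ⟩
    1# * 1#
      ≈⟨ *-identityˡ 1# ⟩
    1# ∎
    where
    q : ℝ
    q = 1# - u

    0≤q : 0# ≤ q
    0≤q = x≤y⇒0≤y-x u≤1

-- Isomorphism of unordered forests

module _ {A : Set} where
  private variable
    t u v : Tree A
    ts us vs : Forest A

  mutual
    ≅ᵗ-refl : Reflexive (_≅ᵗ_ {A})
    ≅ᵗ-refl {node a ts} = node (Homogeneous.refl ≅-refl)

    ≅-refl : Pointwise (_≅ᵗ_ {A}) ts ts
    ≅-refl {[]}     = []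
    ≅-refl {t ∷ ts} = ≅ᵗ-refl ∷ ≅-refl

  mutual
    ≅ᵗ-sym : Symmetric (_≅ᵗ_ {A})
    ≅ᵗ-sym (node ts≅us) = node (≅-sym ts≅us)

    ≅-sym : Symmetric (_≅_ {A})
    ≅-sym (Homogeneous.refl ts≋us)    = Homogeneous.refl (≋-sym ts≋us)
    ≅-sym (Homogeneous.prep e ts≅us)  = Homogeneous.prep (≅ᵗ-sym e) (≅-sym ts≅us)
    ≅-sym (Homogeneous.swap e f ts≅us) = Homogeneous.swap (≅ᵗ-sym f) (≅ᵗ-sym e) (≅-sym ts≅us)
    ≅-sym (Homogeneous.trans p q)     = Homogeneous.trans (≅-sym q) (≅-sym p)

    ≋-sym : Symmetric (Pointwise (_≅ᵗ_ {A}))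
    ≋-sym []       = []
    ≋-sym (e ∷ es) = ≅ᵗ-sym e ∷ ≋-sym es

  mutual
    treeLabels-resp-≅ᵗ : t ≅ᵗ u → treeLabels t ↭ treeLabels u
    treeLabels-resp-≅ᵗ (node ts≅us) = Perm.prep _ (labels-resp-≅ ts≅us)

    -- Makes the weight of a forest, a product over its labels, an invariant of the isomorphism
    -- class.
    labels-resp-≅ : ts ≅ us → labels ts ↭ labels us
    labels-resp-≅ (Homogeneous.refl ts≋us)     = labels-resp-≋ ts≋us
    labels-resp-≅ (Homogeneous.prep e ts≅us)   = ++⁺ (treeLabels-resp-≅ᵗ e) (labels-resp-≅ ts≅us)
    labels-resp-≅ (Homogeneous.swap {x = t} {y = u} e f ts≅us) =
      Perm.trans (shifts (treeLabels t) (treeLabels u))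
                 (++⁺ (treeLabels-resp-≅ᵗ f) (++⁺ (treeLabels-resp-≅ᵗ e) (labels-resp-≅ ts≅us)))
    labels-resp-≅ (Homogeneous.trans p q)      = Perm.trans (labels-resp-≅ p) (labels-resp-≅ q)

    labels-resp-≋ : Pointwise _≅ᵗ_ ts us → labels ts ↭ labels us
    labels-resp-≋ []       = Perm.refl
    labels-resp-≋ (e ∷ es) = ++⁺ (treeLabels-resp-≅ᵗ e) (labels-resp-≋ es)

  ↭⇒≅ : _↭_ ⇒ (_≅_ {A})
  ↭⇒≅ ts↭us = Homogeneous.map (λ { ≡.refl → ≅ᵗ-refl }) (↭⇒↭ₛ ts↭us)

  length-treeLabels≤ : t ∈ˡ ts → length (treeLabels t) ℕ.≤ length (labels ts)
  length-treeLabels≤ {t} (here ≡.refl) = ℕ.≤-trans (ℕ.m≤m+n _ _) (ℕ.≤-reflexive (≡.sym (length-++ (treeLabels t))))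
  length-treeLabels≤ {ts = u ∷ _} (there t∈ts) =
    ℕ.≤-trans (length-treeLabels≤ t∈ts) (ℕ.≤-trans (ℕ.m≤n+m _ _) (ℕ.≤-reflexive (≡.sym (length-++ (treeLabels u)))))

-- Enumeration of witness forests up to isomorphism

module _ {m : ℕ} where
  private
    Label : Set
    Label = Fin m

  elements-unique : (S : Subset m) → Unique (elements S)
  elements-unique S = filter⁺ (_∈? S) (allFin⁺ m)

  ∈-labelSet⁺ : (ts : Forest Label) {i : Label} → i ∈ˡ map label ts → i ∈ labelSet ts
  ∈-labelSet⁺ (t ∷ ts) (here ≡.refl)  = x∈p∪q⁺ (inj₁ (x∈⁅x⁆ _))
  ∈-labelSet⁺ (t ∷ ts) (there i∈ts)   = x∈p∪q⁺ (inj₂ (∈-labelSet⁺ ts i∈ts))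

  ∈-labelSet⁻ : (ts : Forest Label) {i : Label} → i ∈ labelSet ts → i ∈ˡ map label ts
  ∈-labelSet⁻ []       i∈ = contradiction i∈ ∉⊥
  ∈-labelSet⁻ (t ∷ ts) i∈ with x∈p∪q⁻ ⁅ label t ⁆ (labelSet ts) i∈
  ... | inj₁ i∈t  = here (x∈⁅y⁆⇒x≡y _ i∈t)
  ... | inj₂ i∈ts = there (∈-labelSet⁻ ts i∈ts)

  -- Both lists are free of duplicates and have the same members. Distinctness is essential, since
  -- `labelSet` forgets multiplicities.
  labels↭elements : (ts : Forest Label) → Unique (map label ts) → map label ts ↭ elements (labelSet ts)
  labels↭elements ts ts! = ∼bag⇒↭ (unique∧set⇒bag ts! (elements-unique (labelSet ts))
    (mk⇔ (λ i∈ts → ∈-filter⁺ (_∈? labelSet ts) (∈-allFin _) (∈-labelSet⁺ ts i∈ts))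
         (λ i∈S → ∈-labelSet⁻ ts (proj₂ (∈-filter⁻ (_∈? labelSet ts) {xs = allFin m} i∈S)))))

  -- Every isomorphism class of forests has a representative in which siblings are ordered by their labels; these
  -- representatives are enumerated, up to a bound on their height.

  forestsOn : (Label → List (Tree Label)) → List Label → List (Forest Label)
  forestsOn T []       = [ [] ]
  forestsOn T (i ∷ is) = cartesianProductWith _∷_ (T i) (forestsOn T is)

  forestsFrom : (Label → List (Tree Label)) → Family m → List (Forest Label)
  forestsFrom T 𝒮 = concatMap (forestsOn T ∘ elements) (members 𝒮)

  -- The first argument after the families bounds the height, counted in vertices: a single vertex
  -- has height 1, so the list for 0 is empty.
  trees : (Label → Family m) → ℕ → Label → List (Tree Label)
  trees 𝓛 zero    i = []
  trees 𝓛 (suc d) i = map (node i) (forestsFrom (trees 𝓛 d) (𝓛 i))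

  forestsOn-complete : {T : Label → List (Tree Label)} {us : Forest Label} →
    All (λ u → ∃[ v ] v ∈ˡ T (label u) × u ≅ᵗ v) us →
    ∃[ vs ] vs ∈ˡ forestsOn T (map label us) × Pointwise _≅ᵗ_ us vs
  forestsOn-complete []                     = [] , here ≡.refl , []
  forestsOn-complete ((v , v∈T , u≅v) ∷ us∈T) with forestsOn-complete us∈T
  ... | vs , vs∈ , us≋vs = v ∷ vs , ∈-cartesianProductWith⁺ _∷_ v∈T vs∈ , u≅v ∷ us≋vs

  -- The trees are first sorted by their root labels and then replaced one by one by
  -- representatives; the isomorphism is the composite of the two changes.
  forestsFrom-complete : {T : Label → List (Tree Label)} (𝒮 : Family m) {ts : Forest Label} →
    DistinctlyLabelledBy 𝒮 ts → All (λ t → ∃[ v ] v ∈ˡ T (label t) × t ≅ᵗ v) ts →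
    ∃[ vs ] vs ∈ˡ forestsFrom T 𝒮 × ts ≅ vs
  forestsFrom-complete {T} 𝒮 {ts} (ts! , S∈𝒮) ts∈T with ↭-map-inv label (labels↭elements ts ts!)
  ... | us , elements≡us , ts↭us with forestsOn-complete (All-resp-↭ ts↭us ts∈T)
  ...   | vs , vs∈ , us≋vs =
    vs ,
    ∈-concatMap⁺ (forestsOn T ∘ elements)
      (Any.map (λ { ≡.refl → ≡.subst (λ is → vs ∈ˡ forestsOn T is) (≡.sym elements≡us) vs∈ }) S∈𝒮) ,
    Homogeneous.trans (↭⇒≅ ts↭us) (Homogeneous.refl us≋vs)

  -- The number of vertices serves as the bound on the height: it drops by at least one on passing
  -- to a child.
  trees-complete : (𝓛 : Label → Family m) → ∀ d {t} → length (treeLabels t) ℕ.≤ d → ChildrenFrom 𝓛 t →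
    ∃[ v ] v ∈ˡ trees 𝓛 d (label t) × t ≅ᵗ v
  trees-complete 𝓛 (suc d) {node i ts} (s≤s size≤d) (node ts-from ts-children)
    with forestsFrom-complete (𝓛 i) ts-from (All.tabulate (λ t∈ts →
           trees-complete 𝓛 d (ℕ.≤-trans (length-treeLabels≤ t∈ts) size≤d) (All.lookup ts-children t∈ts)))
  ... | vs , vs∈ , ts≅vs = node i vs , ∈-map⁺ (node i) vs∈ , node ts≅vs

-- Total weight of the witness forests

module ForestWeights (ℛ : CompleteOrderedField) where
  open CompleteOrderedField ℛ
  open OrderedField ℛ
  open ≤-Reasoning

  private variable
    m : ℕ

  treeWeight : (Fin m → ℝ) → Tree (Fin m) → ℝ
  treeWeight g t = productOver (treeLabels t) g

  forestWeight : (Fin m → ℝ) → Forest (Fin m) → ℝ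
  forestWeight g ts = productOver (labels ts) g

  familyWeight : (Fin m → ℝ) → Family m → ℝ
  familyWeight ψ 𝒮 = ∑[ S ∈ members 𝒮 ] (∏[ j ∈ elements S ] ψ j)

  module _ {m : ℕ} (g : Fin m → ℝ) (0≤g : ∀ i → 0# ≤ g i) where

    -- Distributivity: the trees at the different roots are chosen independently and the weight is
    -- multiplicative.
    sum-forestsOn : (T : Fin m → List (Tree (Fin m))) (is : List (Fin m)) →
      sumOver (forestsOn T is) (forestWeight g) ≈ ∏[ i ∈ is ] sumOver (T i) (treeWeight g)
    sum-forestsOn T []       = +-identityʳ 1#
    sum-forestsOn T (i ∷ is) = ≈-trans
      (sum-cartesianProductWith _∷_ (treeWeight g) (forestWeight g) (forestWeight g)
        (λ t ts → product-++ g (treeLabels t) (labels ts)) (T i) (forestsOn T is))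
      (*-congˡ (sum-forestsOn T is))

    treeWeight-nonNegative : ∀ t → 0# ≤ treeWeight g t
    treeWeight-nonNegative t = product-nonNegative (treeLabels t) 0≤g

    sum-forestsFrom : (T : Fin m → List (Tree (Fin m))) (ψ : Fin m → ℝ) →
      (∀ i → sumOver (T i) (treeWeight g) ≤ ψ i) → (𝒮 : Family m) →
      sumOver (forestsFrom T 𝒮) (forestWeight g) ≤ familyWeight ψ 𝒮
    sum-forestsFrom T ψ T≤ψ 𝒮 = begin
      sumOver (forestsFrom T 𝒮) (forestWeight g)
        ≈⟨ sum-concatMap (forestWeight g) (forestsOn T ∘ elements) (members 𝒮) ⟩
      ∑[ S ∈ members 𝒮 ] sumOver (forestsOn T (elements S)) (forestWeight g)
        ≈⟨ sum-cong (members 𝒮) (λ S → sum-forestsOn T (elements S)) ⟩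
      (∑[ S ∈ members 𝒮 ] (∏[ i ∈ elements S ] sumOver (T i) (treeWeight g)))
        ≤⟨ sum-mono (members 𝒮) (λ S → product-mono (elements S)
             (λ i → sum-nonNegative (T i) treeWeight-nonNegative) T≤ψ) ⟩
      familyWeight ψ 𝒮 ∎

    module _ (𝓛 : Fin m → Family m) (ψ : Fin m → ℝ) (0≤ψ : ∀ i → 0# ≤ ψ i)
             (g*𝓛≤ψ : ∀ i → g i * familyWeight ψ (𝓛 i) ≤ ψ i) where

      -- The total weights satisfy a monotone recursion in d that starts at 0, and `g*𝓛≤ψ` says that
      -- ψ is a supersolution of it; hence no iterate exceeds ψ.
      sum-trees : ∀ d i → sumOver (trees 𝓛 d i) (treeWeight g) ≤ ψ i
      sum-trees zero    i = 0≤ψ i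
      sum-trees (suc d) i = begin
        sumOver (map (node i) (forestsFrom (trees 𝓛 d) (𝓛 i))) (treeWeight g)
          ≈⟨ sum-map (treeWeight g) (node i) (forestsFrom (trees 𝓛 d) (𝓛 i)) ⟩
        ∑[ ts ∈ forestsFrom (trees 𝓛 d) (𝓛 i) ] (g i * forestWeight g ts)
          ≈⟨ sum-*ˡ (g i) (forestWeight g) (forestsFrom (trees 𝓛 d) (𝓛 i)) ⟩
        g i * sumOver (forestsFrom (trees 𝓛 d) (𝓛 i)) (forestWeight g)
          ≤⟨ *-monoʳ-≤ (0≤g i) (sum-forestsFrom (trees 𝓛 d) ψ (sum-trees d) (𝓛 i)) ⟩
        g i * familyWeight ψ (𝓛 i)
          ≤⟨ g*𝓛≤ψ i ⟩
        ψ i ∎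

      -- Passing from `φ w` to its representative keeps injectivity, since φ separates isomorphism
      -- classes, and keeps the weight, since the labels of the forest are those of w. A forest with
      -- t vertices has height at most t, so `trees 𝓛 t` suffices.
      sum-witnesses : (Roots : Family m) (t : ℕ) {ws : List (List (Fin m))} → Unique ws →
        (φ : List (Fin m) → Forest (Fin m)) →
        (∀ {w} → w ∈ˡ ws → length w ≡ t × IsWitnessForest Roots 𝓛 w (φ w)) →
        (∀ {w w′} → w ∈ˡ ws → w′ ∈ˡ ws → φ w ≅ φ w′ → w ≡ w′) →
        ∑[ w ∈ ws ] productOver w g ≤ familyWeight ψ Roots
      sum-witnesses Roots t {ws} ws! φ witness φ-injective = ≤-trans
        -- Membership in `ws` is part of the relation because φ is known to be injective on `ws`
        -- only.
        (sum-injection (λ w F → w ∈ˡ ws × φ w ≅ F) _ (forestWeight g) (λ F → product-nonNegative (labels F) 0≤g)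
          (λ { (w∈ws , φw≅F) (w′∈ws , φw′≅F) →
               φ-injective w∈ws w′∈ws (Homogeneous.trans φw≅F (≅-sym φw′≅F)) })
          ws! (forestsFrom (trees 𝓛 t) Roots) representative)
        (sum-forestsFrom (trees 𝓛 t) ψ (sum-trees t) Roots)
        where
        representative : ∀ {w} → w ∈ˡ ws →
          ∃[ F ] F ∈ˡ forestsFrom (trees 𝓛 t) Roots × (w ∈ˡ ws × φ w ≅ F) × productOver w g ≤ forestWeight g F
        representative {w} w∈ws with witness w∈ws
        ... | length≡t , record { labels-↭ = labels↭w ; roots = roots ; children = children }
          with forestsFrom-complete Roots roots (All.tabulate (λ t∈φw →
                 trees-complete 𝓛 t
                   (ℕ.≤-trans (length-treeLabels≤ t∈φw) (ℕ.≤-reflexive (≡.trans (↭-length labels↭w) length≡t)))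
                   (All.lookup children t∈φw)))
        ...   | F , F∈ , φw≅F = F , F∈ , (w∈ws , φw≅F) , ≤-reflexive (product-↭ g
                  (Perm.trans (↭-sym labels↭w) (labels-resp-≅ φw≅F)))

-- Charges and the law of the walk

module RandomWalk (ℛ : CompleteOrderedField) where
  open CompleteOrderedField ℛ
  open Probability ℛ
  open OrderedField ℛ
  open ForestWeights ℛ
  open Solver using (solve; _:=_; _:+_; _:*_; con)
  open ≤-Reasoning

  module Analysis
    {n m : ℕ} (D : FlawDigraph n m)
    (ρ : Fin m → Fin n → Fin n → ℝ) (ρ-transition : IsTransition D ρ)
    (θ : Fin n → ℝ) (θ-distribution : IsDistribution θ)
    (μ : Fin n → ℝ) (μ-distribution : IsDistribution μ) (0<μ : ∀ σ → 0# < μ σ)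
    (𝒜 : FlawChoice D)
    where
    open FlawDigraph D
    open FlawChoice 𝒜
    open Walk D ρ θ 𝒜
    open Charges D ρ θ μ
    open IsTransition ρ-transition

    0≤μ : ∀ σ → 0# ≤ μ σ
    0≤μ = proj₁ ∘ 0<μ

    ∈-elements⁺ : ∀ {k} {S : Subset k} {i} → i ∈ S → i ∈ˡ elements S
    ∈-elements⁺ {S = S} i∈S = ∈-filter⁺ (_∈? S) (∈-allFin _) i∈S

    0<measure : ∀ i → 0# < measure μ (flaw i)
    0<measure i with flaw-nonempty i
    ... | σ , σ∈fᵢ = <-≤-trans (0<μ σ) (term≤sum (λ {a} _ → 0≤μ a) (∈-elements⁺ σ∈fᵢ))

    maxDistortion : Flaw → ℝ
    maxDistortion i = max[ σ ∈ elements (flaw i) ] distortion i σ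

    0≤maxDistortion : ∀ i → 0# ≤ maxDistortion i
    0≤maxDistortion i = max-nonNegative (distortion i) (elements (flaw i))

    γ-nonNegative : ∀ i → 0# ≤ γ i
    γ-nonNegative i = helper regenerative?
      where
      helper : (r? : Dec Regenerative) → 0# ≤ (if does r? then measure μ (flaw i) else fromℕ (b i) * maxDistortion i)
      helper (yes _) = proj₁ (0<measure i)
      helper (no _)  = *-nonNegative (fromℕ-nonNegative (b i)) (0≤maxDistortion i)

    -- Only states with an arc into τ contribute. There are at most `b i` of them, and by the
    -- definition of distortion each contributes at most `maxDistortion i * μ τ`.
    flow-into : ∀ i τ → ∑[ σ ∈ elements (flaw i) ] (μ σ * ρ i σ τ) ≤ fromℕ (b i) * maxDistortion i * μ τ
    flow-into i τ = begin
      ∑[ σ ∈ elements (flaw i) ] (μ σ * ρ i σ τ)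
        ≈⟨ sum-filter (_∈? flaw i) _ (allFin n) ⟩
      ∑[ σ ∈ allFin n ] when (σ ∈? flaw i) (μ σ * ρ i σ τ)
        ≤⟨ sum-mono (allFin n) bound ⟩
      ∑[ σ ∈ allFin n ] when (arc? i σ τ) (maxDistortion i * μ τ)
        ≈⟨ sum-filter (λ σ → arc? i σ τ) _ (allFin n) ⟨
      ∑[ σ ∈ filter (λ σ → arc? i σ τ) (allFin n) ] (maxDistortion i * μ τ)
        ≈⟨ sum-constant (maxDistortion i * μ τ) (filter (λ σ → arc? i σ τ) (allFin n)) ⟩
      fromℕ (inDegree i τ) * (maxDistortion i * μ τ)
        ≤⟨ *-monoˡ-≤ 0≤c (fromℕ-mono inDegree≤b) ⟩
      fromℕ (b i) * (maxDistortion i * μ τ)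
        ≈⟨ *-assoc _ _ _ ⟨
      fromℕ (b i) * maxDistortion i * μ τ ∎
      where
      0≤c : 0# ≤ maxDistortion i * μ τ
      0≤c = *-nonNegative (0≤maxDistortion i) (0≤μ τ)

      inDegree≤b : inDegree i τ ℕ.≤ b i
      inDegree≤b = All.lookup (ℕExtrema.xs≤max 0 _) (∈-map⁺ (inDegree i) (∈-allFin τ))

      bound : ∀ σ → when (σ ∈? flaw i) (μ σ * ρ i σ τ) ≤ when (arc? i σ τ) (maxDistortion i * μ τ)
      bound σ with σ ∈? flaw i | τ ∈? actions i σ
      ... | no _     | _       = ≤-refl
      ... | yes σ∈fᵢ | no τ∉A  = ≤-reflexive (≈-trans (*-congˡ (support σ∈fᵢ τ∉A)) (zeroʳ _))
      ... | yes σ∈fᵢ | yes τ∈A = x/z≤y⇒x≤y*z (0<μ τ) (begin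
        μ σ * ρ i σ τ / μ τ    ≈⟨ solve 3 (λ x y z → x :* y :* z := y :* (x :* z)) ≈-refl _ _ _ ⟩
        ρ i σ τ * (μ σ / μ τ)  ≤⟨ f≤max _ (∈-elements⁺ τ∈A) ⟩
        distortion i σ         ≤⟨ f≤max (distortion i) (∈-elements⁺ σ∈fᵢ) ⟩
        maxDistortion i        ∎)

    flow≤γμ : ∀ i τ → ∑[ σ ∈ elements (flaw i) ] (μ σ * ρ i σ τ) ≤ γ i * μ τ
    flow≤γμ i τ = helper regenerative?
      where
      helper : (r? : Dec Regenerative) → ∑[ σ ∈ elements (flaw i) ] (μ σ * ρ i σ τ) ≤
               (if does r? then measure μ (flaw i) else fromℕ (b i) * maxDistortion i) * μ τ
      helper (no _)                  = flow-into i τ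
      -- Regeneration gives equality, after multiplication by the measure of the flaw.
      helper (yes (regenerates , _)) = begin
        flow                ≈⟨ *-identityˡ flow ⟨
        1# * flow           ≈⟨ *-congʳ (*-inverseʳ (0<measure i)) ⟨
        M * M ⁻¹ * flow     ≈⟨ solve 3 (λ x y z → x :* y :* z := x :* (con 1 :* y :* z)) ≈-refl _ _ _ ⟩
        M * (1# / M * flow) ≈⟨ *-congˡ (regenerates i τ) ⟩
        M * μ τ             ∎
        where
        M flow : ℝ
        M = measure μ (flaw i)
        flow = ∑[ σ ∈ elements (flaw i) ] (μ σ * ρ i σ τ)

    -- Addressing flaw i as an operator on test functions: the expected value of f after the step.
    -- It is cut off to 0 outside the flaw, where `ρ i σ` is meaningless.
    push : Flaw → (State → ℝ) → State → ℝ
    push i f σ = when (σ ∈? flaw i) (∑[ τ ∈ allFin n ] (ρ i σ τ * f τ))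

    push-nonNegative : ∀ i {f} → (∀ τ → 0# ≤ f τ) → ∀ σ → 0# ≤ push i f σ
    push-nonNegative i 0≤f σ with σ ∈? flaw i
    ... | yes σ∈fᵢ = sum-nonNegative (allFin n) (λ τ → *-nonNegative (nonNegative σ∈fᵢ τ) (0≤f τ))
    ... | no  _    = ≤-refl

    -- After the two sums are exchanged, this is `flow≤γμ` integrated against f.
    push-expectation : ∀ i {f} → (∀ τ → 0# ≤ f τ) →
      ∑[ σ ∈ allFin n ] (μ σ * push i f σ) ≤ γ i * (∑[ τ ∈ allFin n ] (μ τ * f τ))
    push-expectation i {f} 0≤f = begin
      ∑[ σ ∈ allFin n ] (μ σ * push i f σ)
        ≈⟨ sum-cong (allFin n) (λ σ → when-*ˡ (σ ∈? flaw i) (μ σ)) ⟩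
      ∑[ σ ∈ allFin n ] when (σ ∈? flaw i) (μ σ * (∑[ τ ∈ allFin n ] (ρ i σ τ * f τ)))
        ≈⟨ sum-filter (_∈? flaw i) _ (allFin n) ⟨
      ∑[ σ ∈ elements (flaw i) ] (μ σ * (∑[ τ ∈ allFin n ] (ρ i σ τ * f τ)))
        ≈⟨ sum-cong (elements (flaw i)) (λ σ → sum-*ˡ (μ σ) (λ τ → ρ i σ τ * f τ) (allFin n)) ⟨
      (∑[ σ ∈ elements (flaw i) ] (∑[ τ ∈ allFin n ] (μ σ * (ρ i σ τ * f τ))))
        ≈⟨ sum-swap _ (elements (flaw i)) (allFin n) ⟩
      (∑[ τ ∈ allFin n ] (∑[ σ ∈ elements (flaw i) ] (μ σ * (ρ i σ τ * f τ))))
        ≈⟨ sum-cong (allFin n) (λ τ → sum-cong (elements (flaw i)) (λ σ → *-assoc (μ σ) (ρ i σ τ) (f τ))) ⟨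
      (∑[ τ ∈ allFin n ] (∑[ σ ∈ elements (flaw i) ] (μ σ * ρ i σ τ * f τ)))
        ≈⟨ sum-cong (allFin n) (λ τ → sum-*ʳ (f τ) (λ σ → μ σ * ρ i σ τ) (elements (flaw i))) ⟩
      ∑[ τ ∈ allFin n ] ((∑[ σ ∈ elements (flaw i) ] (μ σ * ρ i σ τ)) * f τ)
        ≤⟨ sum-mono (allFin n) (λ τ → *-monoˡ-≤ (0≤f τ) (flow≤γμ i τ)) ⟩
      ∑[ τ ∈ allFin n ] (γ i * μ τ * f τ)
        ≈⟨ sum-cong (allFin n) (λ τ → *-assoc (γ i) (μ τ) (f τ)) ⟩
      ∑[ τ ∈ allFin n ] (γ i * (μ τ * f τ))
        ≈⟨ sum-*ˡ (γ i) (λ τ → μ τ * f τ) (allFin n) ⟩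
      γ i * (∑[ τ ∈ allFin n ] (μ τ * f τ)) ∎

    -- A view of `advance` that forgets how the flaw is chosen and keeps only that it is present.
    -- Beyond this, the mechanism enters the analysis through traceability alone.
    data Step (h : Trajectory) (p : ℝ) : List (Trajectory × ℝ) → Set where
      stopped : Sink (last h) → Step h p ((h , p) ∷ [])
      moved   : ∀ i → ¬ Sink (last h) → last h ∈ flaw i →
                Step h p (map (λ τ → h ⟶[ i ] τ , p * ρ i (last h) τ) (elements (actions i (last h))))

    step : ∀ h p → Step h p (advance (h , p))
    step h p with sink? (last h)
    ... | yes sink  = stopped sink
    ... | no  ¬sink = moved (choose h ¬sink) ¬sink
      (lookup⇒[]= _ _ (≡.trans (≡.sym (lookup∘tabulate _ (choose h ¬sink))) ([]=⇒lookup (choose-present h ¬sink))))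

    length-∷ʳ : {A : Set} (xs : List A) {x : A} → length (xs ∷ʳ x) ≡ suc (length xs)
    length-∷ʳ xs = ≡.trans (length-++ xs) (ℕ.+-comm (length xs) 1)

    -- The invariant of `law k`: stopped trajectories may have fewer than k steps, but one that is
    -- not at a sink has exactly k.
    record Reachable (k : ℕ) (x : Trajectory × ℝ) : Set where
      constructor reachable
      field
        nonNegative-prob : 0# ≤ proj₂ x
        length≤          : length (addressed (proj₁ x)) ℕ.≤ k
        running          : ¬ Sink (last (proj₁ x)) → length (addressed (proj₁ x)) ≡ k
    open Reachable

    law-reachable : ∀ k → All (Reachable k) (law k)
    law-reachable zero    = All.map⁺ (All.universal (λ σ → reachable (proj₁ θ-distribution σ) z≤n (λ _ → ≡.refl)) _)
    law-reachable (suc k) =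
      All.concat⁺ (All.map⁺ (All.map (λ {x} → advance-reachable (proj₁ x) (proj₂ x)) (law-reachable k)))
      where
      advance-reachable : ∀ h p → Reachable k (h , p) → All (Reachable (suc k)) (advance (h , p))
      advance-reachable h p (reachable 0≤p len≤k running) with advance (h , p) | step h p
      ... | _ | stopped sink        = reachable 0≤p (ℕ.m≤n⇒m≤1+n len≤k) (λ ¬sink → contradiction sink ¬sink) ∷ []
      ... | _ | moved i ¬sink σ∈fᵢ = All.map⁺ (All.universal (λ τ → reachable
        (*-nonNegative 0≤p (nonNegative σ∈fᵢ τ))
        (ℕ.≤-trans (ℕ.≤-reflexive (length-∷ʳ (addressed h))) (s≤s len≤k))
        (λ _ → ≡.trans (length-∷ʳ (addressed h)) (≡.cong suc (running ¬sink)))) _)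

    law-nonNegative : ∀ k {x} → x ∈ˡ law k → 0# ≤ proj₂ x
    law-nonNegative k x∈ = nonNegative-prob (All.lookup (law-reachable k) x∈)

    law-total : ∀ k → sumOver (law k) proj₂ ≈ 1#
    law-total zero    = ≈-trans (sum-map proj₂ _ (allFin n)) (proj₂ θ-distribution)
    law-total (suc k) = ≈-trans (sum-concatMap proj₂ advance (law k))
      (≈-trans (sum-cong (law k) (λ x → advance-total (proj₁ x) (proj₂ x))) (law-total k))
      where
      advance-total : ∀ h p → sumOver (advance (h , p)) proj₂ ≈ p
      advance-total h p with advance (h , p) | step h p
      ... | _ | stopped _        = +-identityʳ p
      ... | _ | moved i _ σ∈fᵢ = begin-equality
        sumOver (map _ (elements (actions i (last h)))) proj₂     ≈⟨ sum-map proj₂ _ (elements (actions i (last h))) ⟩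
        ∑[ τ ∈ elements (actions i (last h)) ] (p * ρ i (last h) τ)
          ≈⟨ sum-*ˡ p (ρ i (last h)) (elements (actions i (last h))) ⟩
        p * sumOver (elements (actions i (last h))) (ρ i (last h)) ≈⟨ *-congˡ (total σ∈fᵢ) ⟩
        p * 1#                                                     ≈⟨ *-identityʳ p ⟩
        p                                                          ∎

    infix 4 _≟_
    _≟_ : DecidableEquality (List Flaw)
    _≟_ = ≡-dec Fin._≟_

    density : ℝ
    density = max[ σ ∈ allFin n ] (θ σ / μ σ)

    θ≤density*μ : ∀ σ → θ σ ≤ density * μ σ
    θ≤density*μ σ = x/z≤y⇒x≤y*z (0<μ σ) (f≤max (λ σ → θ σ / μ σ) (∈-allFin σ))

    0≤density : 0# ≤ density
    0≤density = max-nonNegative _ (allFin n)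

    -- Otherwise θ, dominated by `density * μ`, would have total mass 0. Positivity gives access to
    -- `2^-log₂`.
    0<density : 0# < density
    0<density = 0≤density , λ 0≈density → contradiction (≤-antisym 0≤1 (begin
      1#                                    ≈⟨ proj₂ θ-distribution ⟨
      ∑[ σ ∈ allFin n ] θ σ                 ≤⟨ sum-mono (allFin n) θ≤density*μ ⟩
      ∑[ σ ∈ allFin n ] (density * μ σ)     ≈⟨ sum-zero (allFin n) (λ σ →
                                                  ≈-trans (*-congʳ (≈-sym 0≈density)) (zeroˡ (μ σ))) ⟩
      0#                                    ∎)) 0≉1

    -- The law of the last state on the event that the witness sequence is w, viewed as a functional
    -- of f.
    expectationOn : ℕ → List Flaw → (State → ℝ) → ℝ
    expectationOn t w f = ∑[ x ∈ law t ] when (addressed (proj₁ x) ≟ w) (proj₂ x * f (last (proj₁ x)))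

    -- A trajectory with witness sequence `w ∷ʳ i` extends one with sequence w by addressing i.
    -- There is no equality in general: where the mechanism addresses another flaw after w, the left
    -- side gets nothing and the right side something non-negative.
    expectationOn-step : ∀ t w i {f} → (∀ τ → 0# ≤ f τ) → length w ≡ t →
      expectationOn (suc t) (w ∷ʳ i) f ≤ expectationOn t w (push i f)
    expectationOn-step t w i {f} 0≤f |w|≡t = begin
      expectationOn (suc t) (w ∷ʳ i) f
        ≈⟨ sum-concatMap term advance (law t) ⟩
      ∑[ x ∈ law t ] sumOver (advance x) term
        ≤⟨ sum-mono-∈ (law t) (λ {x} x∈ → advance-≤ (proj₁ x) (proj₂ x) (All.lookup (law-reachable t) x∈)) ⟩
      expectationOn t w (push i f) ∎
      where
      term : Trajectory × ℝ → ℝ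
      term x = when (addressed (proj₁ x) ≟ w ∷ʳ i) (proj₂ x * f (last (proj₁ x)))

      advance-≤ : ∀ h p → Reachable t (h , p) →
        sumOver (advance (h , p)) term ≤ when (addressed h ≟ w) (p * push i f (last h))
      advance-≤ h p (reachable 0≤p len≤t _) with advance (h , p) | step h p
      ... | _ | stopped _ = begin
        term (h , p) + 0# ≈⟨ +-identityʳ _ ⟩
        term (h , p)      ≈⟨ when-false (addressed h ≟ w ∷ʳ i) h≢w∷ʳi ⟩
        0#                ≤⟨ when-nonNegative (addressed h ≟ w) (*-nonNegative 0≤p (push-nonNegative i 0≤f (last h))) ⟩
        when (addressed h ≟ w) (p * push i f (last h)) ∎
        where
        -- A stopped trajectory has at most t steps, whereas `w ∷ʳ i` has t + 1 entries.
        h≢w∷ʳi : ¬ addressed h ≡ w ∷ʳ i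
        h≢w∷ʳi h≡ = ℕ.1+n≰n (≡.subst (ℕ._≤ t) (≡.trans (≡.cong length h≡) (≡.trans (length-∷ʳ w) (≡.cong suc |w|≡t))) len≤t)
      ... | _ | moved j _ σ∈fⱼ = ≤-trans (≤-reflexive (sum-map term _ successors)) (moved-≤ (addressed h ∷ʳ j ≟ w ∷ʳ i))
        where
        σ : State
        σ = last h

        successors : List State
        successors = elements (actions j σ)

        moved-≤ : Dec (addressed h ∷ʳ j ≡ w ∷ʳ i) →
          ∑[ τ ∈ successors ] when (addressed h ∷ʳ j ≟ w ∷ʳ i) (p * ρ j σ τ * f τ) ≤ when (addressed h ≟ w) (p * push i f σ)
        moved-≤ (no h∷ʳj≢) = begin
          _  ≈⟨ sum-zero successors (λ τ → when-false (addressed h ∷ʳ j ≟ w ∷ʳ i) h∷ʳj≢) ⟩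
          0# ≤⟨ when-nonNegative (addressed h ≟ w) (*-nonNegative 0≤p (push-nonNegative i 0≤f σ)) ⟩
          _  ∎
        moved-≤ (yes h∷ʳj≡) with ∷ʳ-injective (addressed h) w h∷ʳj≡
        ... | h≡w , ≡.refl = begin
          ∑[ τ ∈ successors ] when (addressed h ∷ʳ j ≟ w ∷ʳ i) (p * ρ i σ τ * f τ)
            ≈⟨ sum-cong successors (λ τ → when-true (addressed h ∷ʳ j ≟ w ∷ʳ i) h∷ʳj≡) ⟩
          ∑[ τ ∈ successors ] (p * ρ i σ τ * f τ)
            ≤⟨ sum-filter-≤ (_∈? actions i σ) (allFin n)
                 (λ τ → *-nonNegative (*-nonNegative 0≤p (nonNegative σ∈fⱼ τ)) (0≤f τ)) ⟩
          ∑[ τ ∈ allFin n ] (p * ρ i σ τ * f τ)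
            ≈⟨ sum-cong (allFin n) (λ τ → *-assoc p (ρ i σ τ) (f τ)) ⟩
          ∑[ τ ∈ allFin n ] (p * (ρ i σ τ * f τ))
            ≈⟨ sum-*ˡ p (λ τ → ρ i σ τ * f τ) (allFin n) ⟩
          p * (∑[ τ ∈ allFin n ] (ρ i σ τ * f τ))
            ≈⟨ *-congˡ (when-true (σ ∈? flaw i) σ∈fⱼ) ⟨
          p * push i f σ
            ≈⟨ when-true (addressed h ≟ w) h≡w ⟨
          when (addressed h ≟ w) (p * push i f σ) ∎

    -- Induction from the last flaw of w, with f varying: removing i turns f into `push i f` at the
    -- price of a factor `γ i`. At the start, θ is compared with `density * μ`.
    expectationOn-≤ : ∀ t w → length w ≡ t → ∀ {f} → (∀ τ → 0# ≤ f τ) →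
      expectationOn t w f ≤ density * productOver w γ * (∑[ τ ∈ allFin n ] (μ τ * f τ))
    expectationOn-≤ zero [] _ {f} 0≤f = begin
      expectationOn zero [] f                          ≈⟨ sum-map _ _ (allFin n) ⟩
      ∑[ σ ∈ allFin n ] (θ σ * f σ)                 ≤⟨ sum-mono (allFin n) (λ σ → *-monoˡ-≤ (0≤f σ) (θ≤density*μ σ)) ⟩
      ∑[ σ ∈ allFin n ] (density * μ σ * f σ)
        ≈⟨ sum-cong (allFin n) (λ σ → solve 3 (λ x y z → x :* y :* z := (x :* con 1) :* (y :* z)) ≈-refl density (μ σ) (f σ)) ⟩
      ∑[ σ ∈ allFin n ] (density * 1# * (μ σ * f σ)) ≈⟨ sum-*ˡ (density * 1#) (λ σ → μ σ * f σ) (allFin n) ⟩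
      density * 1# * (∑[ σ ∈ allFin n ] (μ σ * f σ)) ∎
    expectationOn-≤ (suc t) w |w|≡ {f} 0≤f with initLast w
    ... | w′ ∷ʳ′ i = begin
      expectationOn (suc t) (w′ ∷ʳ i) f
        ≤⟨ expectationOn-step t w′ i 0≤f |w′|≡t ⟩
      expectationOn t w′ (push i f)
        ≤⟨ expectationOn-≤ t w′ |w′|≡t (push-nonNegative i 0≤f) ⟩
      density * productOver w′ γ * (∑[ σ ∈ allFin n ] (μ σ * push i f σ))
        ≤⟨ *-monoʳ-≤ (*-nonNegative 0≤density (product-nonNegative w′ γ-nonNegative)) (push-expectation i 0≤f) ⟩
      density * productOver w′ γ * (γ i * (∑[ τ ∈ allFin n ] (μ τ * f τ)))
        ≈⟨ solve 4 (λ x y z u → x :* y :* (z :* u) := x :* (y :* (z :* con 1)) :* u) ≈-refl _ _ _ _ ⟩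
      density * (productOver w′ γ * (γ i * 1#)) * (∑[ τ ∈ allFin n ] (μ τ * f τ))
        ≈⟨ *-congʳ (*-congˡ (product-++ γ w′ (i ∷ []))) ⟨
      density * productOver (w′ ∷ʳ i) γ * (∑[ τ ∈ allFin n ] (μ τ * f τ)) ∎
      where
      |w′|≡t : length w′ ≡ t
      |w′|≡t = ℕ.suc-injective (≡.trans (≡.sym (length-∷ʳ w′)) |w|≡)

    -- From failure probability to witness sequences

    probNotSinkWithin : ℕ → ℝ
    probNotSinkWithin k = ∑[ x ∈ law k ] when (¬? (sink? (last (proj₁ x)))) (proj₂ x)

    1≤probSink+probNotSink : ∀ k → 1# ≤ probSinkWithin k + probNotSinkWithin k
    1≤probSink+probNotSink k = ≤-reflexive (begin-equality
      1#
        ≈⟨ law-total k ⟨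
      sumOver (law k) proj₂
        ≈⟨ sum-cong (law k) (λ x → when-complement (sink? (last (proj₁ x)))) ⟨
      ∑[ x ∈ law k ] (when (sink? (last (proj₁ x))) (proj₂ x) + when (¬? (sink? (last (proj₁ x)))) (proj₂ x))
        ≈⟨ sum-+ _ _ (law k) ⟩
      (∑[ x ∈ law k ] when (sink? (last (proj₁ x))) (proj₂ x)) + probNotSinkWithin k
        ≈⟨ +-congʳ (sum-filter (λ x → sink? (last (proj₁ x))) proj₂ (law k)) ⟨
      probSinkWithin k + probNotSinkWithin k ∎)

    probSteps : ℕ → ℝ
    probSteps t = ∑[ x ∈ law t ] when (length (addressed (proj₁ x)) ℕ.≟ t) (proj₂ x)

    -- Outside sinks the transition probabilities sum to 1, so no mass is lost in the next step.
    -- Gaining this step makes up for rounding the bound on the number of steps down to k.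
    probNotSink≤probSteps : ∀ k → probNotSinkWithin k ≤ probSteps (suc k)
    probNotSink≤probSteps k = begin
      probNotSinkWithin k
        ≤⟨ sum-mono-∈ (law k) (λ {x} x∈ → advance-≥ (proj₁ x) (proj₂ x) (All.lookup (law-reachable k) x∈)) ⟩
      ∑[ x ∈ law k ] sumOver (advance x) term
        ≈⟨ sum-concatMap term advance (law k) ⟨
      probSteps (suc k) ∎
      where
      term : Trajectory × ℝ → ℝ
      term x = when (length (addressed (proj₁ x)) ℕ.≟ suc k) (proj₂ x)

      advance-≥ : ∀ h p → Reachable k (h , p) →
        when (¬? (sink? (last h))) p ≤ sumOver (advance (h , p)) term
      advance-≥ h p (reachable 0≤p _ running) with advance (h , p) | step h p
      ... | _ | stopped sink = begin
        when (¬? (sink? (last h))) p  ≈⟨ when-false (¬? (sink? (last h))) (λ ¬sink → ¬sink sink) ⟩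
        0#                            ≤⟨ when-nonNegative (length (addressed h) ℕ.≟ suc k) 0≤p ⟩
        term (h , p)                  ≈⟨ +-identityʳ _ ⟨
        term (h , p) + 0#             ∎
      ... | _ | moved i ¬sink σ∈fᵢ = ≤-reflexive (begin-equality
        when (¬? (sink? (last h))) p                ≈⟨ when-true (¬? (sink? (last h))) ¬sink ⟩
        p                                           ≈⟨ *-identityʳ p ⟨
        p * 1#                                      ≈⟨ *-congˡ (total σ∈fᵢ) ⟨
        p * sumOver successors (ρ i (last h))       ≈⟨ sum-*ˡ p (ρ i (last h)) successors ⟨
        ∑[ τ ∈ successors ] (p * ρ i (last h) τ)    ≈⟨ sum-cong successors (λ τ →
                                                         when-true (length (addressed h ∷ʳ i) ℕ.≟ suc k)
                                                         (≡.trans (length-∷ʳ (addressed h)) (≡.cong suc (running ¬sink)))) ⟨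
        ∑[ τ ∈ successors ] term (h ⟶[ i ] τ , p * ρ i (last h) τ) ≈⟨ sum-map term _ successors ⟨
        sumOver (map _ successors) term             ∎)
        where
        successors : List State
        successors = elements (actions i (last h))

    steps? : ∀ t (x : Trajectory × ℝ) → Dec (0# < proj₂ x × length (addressed (proj₁ x)) ≡ t)
    steps? t x = (0# <? proj₂ x) ×-dec (length (addressed (proj₁ x)) ℕ.≟ t)

    -- Trajectories of probability 0 are dropped because traceability says nothing about them;
    -- several trajectories may share a witness sequence, hence `deduplicate`.
    words : ℕ → List (List Flaw)
    words t = deduplicate _≟_ (map (addressed ∘ proj₁) (filter (steps? t) (law t)))

    words⊆𝒲 : ∀ t {w} → w ∈ˡ words t → 𝒲 t w
    words⊆𝒲 t w∈ with ∈-map⁻ (addressed ∘ proj₁) (∈-deduplicate⁻ _≟_ _ w∈)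
    ... | (h , p) , x∈ , ≡.refl with ∈-filter⁻ (steps? t) {xs = law t} x∈
    ...   | x∈law , 0<p , |w|≡t = h , p , x∈law , 0<p , ≡.refl , |w|≡t

    probSteps≤sum : ∀ t → probSteps t ≤ ∑[ w ∈ words t ] (density * productOver w γ)
    probSteps≤sum t = begin
      probSteps t
        ≤⟨ sum-mono-∈ (law t) bound ⟩
      -- The factor 1 is the constant test function: after the exchange, the inner sum is an
      -- `expectationOn`.
      (∑[ x ∈ law t ] (∑[ w ∈ words t ] when (addressed (proj₁ x) ≟ w) (proj₂ x * 1#)))
        ≈⟨ sum-swap _ (law t) (words t) ⟩
      ∑[ w ∈ words t ] expectationOn t w (λ _ → 1#)
        ≤⟨ sum-mono-∈ (words t) (λ {w} w∈ → expectationOn-≤ t w (length-word w∈) (λ _ → 0≤1)) ⟩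
      ∑[ w ∈ words t ] (density * productOver w γ * (∑[ τ ∈ allFin n ] (μ τ * 1#)))
        ≈⟨ sum-cong (words t) (λ w → ≈-trans (*-congˡ (≈-trans
             (sum-cong (allFin n) (λ τ → *-identityʳ (μ τ))) (proj₂ μ-distribution))) (*-identityʳ _)) ⟩
      ∑[ w ∈ words t ] (density * productOver w γ) ∎
      where
      length-word : ∀ {w} → w ∈ˡ words t → length w ≡ t
      length-word w∈ with words⊆𝒲 t w∈
      ... | _ , _ , _ , _ , _ , |w|≡t = |w|≡t

      term-nonNegative : ∀ {x} → x ∈ˡ law t → ∀ w → 0# ≤ when (addressed (proj₁ x) ≟ w) (proj₂ x * 1#)
      term-nonNegative {x} x∈ w = when-nonNegative (addressed (proj₁ x) ≟ w) (*-nonNegative (law-nonNegative t x∈) 0≤1)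

      bound : ∀ {x} → x ∈ˡ law t → when (length (addressed (proj₁ x)) ℕ.≟ t) (proj₂ x) ≤
              ∑[ w ∈ words t ] when (addressed (proj₁ x) ≟ w) (proj₂ x * 1#)
      bound {h , p} x∈ with length (addressed h) ℕ.≟ t | 0# <? p
      ... | no _      | _      = sum-nonNegative (words t) (term-nonNegative x∈)
      ... | yes _     | no 0≮p = ≤-trans (≮⇒≥ 0≮p) (sum-nonNegative (words t) (term-nonNegative x∈))
      ... | yes |h|≡t | yes 0<p = begin
        p                                                ≈⟨ *-identityʳ p ⟨
        p * 1#                                           ≈⟨ when-true (addressed h ≟ addressed h) ≡.refl ⟨
        when (addressed h ≟ addressed h) (p * 1#)        ≤⟨ term≤sum (λ {w} _ → term-nonNegative x∈ w)
                                                              (∈-deduplicate⁺ _≟_ (∈-map⁺ (addressed ∘ proj₁)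
                                                                (∈-filter⁺ (steps? t) x∈ (0<p , |h|≡t)))) ⟩
        ∑[ w ∈ words t ] when (addressed h ≟ w) (p * 1#) ∎

    -- All words counted have exactly k + 1 letters, so replacing γ by γ/q costs the uniform factor
    -- `q ^ suc k`. The hypothesis on q says precisely that ψ is a supersolution for the new
    -- weights.
    probNotSink-≤ : (Roots : Family m) (𝓛 : Flaw → Family m) → Traceable Roots 𝓛 →
      (ψ : Flaw → ℝ) → (∀ i → 0# ≤ ψ i) → ∀ {q} → 0# < q →
      (∀ i → γ i * familyWeight ψ (𝓛 i) ≤ q * ψ i) →
      ∀ k → probNotSinkWithin k ≤ density * familyWeight ψ Roots * q ^ suc k
    probNotSink-≤ Roots 𝓛 traceable ψ 0≤ψ {q} 0<q γ𝓛≤qψ k with traceable (suc k) (s≤s z≤n)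
    ... | φ , witness , φ-injective = begin
      probNotSinkWithin k
        ≤⟨ ≤-trans (probNotSink≤probSteps k) (probSteps≤sum (suc k)) ⟩
      ∑[ w ∈ words (suc k) ] (density * productOver w γ)
        ≤⟨ sum-mono-∈ (words (suc k)) (λ {w} w∈ → ≤-reflexive (*-congˡ (rescale w (length-word w∈)))) ⟩
      ∑[ w ∈ words (suc k) ] (density * (productOver w g * q ^ suc k))
        ≈⟨ ≈-trans (sum-*ˡ density _ (words (suc k)))
             (*-congˡ (sum-*ʳ (q ^ suc k) (λ w → productOver w g) (words (suc k)))) ⟩
      density * ((∑[ w ∈ words (suc k) ] productOver w g) * q ^ suc k)
        ≈⟨ *-assoc _ _ _ ⟨
      density * (∑[ w ∈ words (suc k) ] productOver w g) * q ^ suc k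
        ≤⟨ *-monoˡ-≤ (^-nonNegative (proj₁ 0<q) (suc k)) (*-monoʳ-≤ 0≤density
             (sum-witnesses g 0≤g 𝓛 ψ 0≤ψ g*𝓛≤ψ Roots (suc k) (Unique.deduplicate-! _≟_ _) φ
               (λ w∈ → length-word w∈ , witness (words⊆𝒲 (suc k) w∈))
               (λ w∈ w′∈ → φ-injective (words⊆𝒲 (suc k) w∈) (words⊆𝒲 (suc k) w′∈)))) ⟩
      density * familyWeight ψ Roots * q ^ suc k ∎
      where
      g : Flaw → ℝ
      g i = γ i / q

      0≤g : ∀ i → 0# ≤ g i
      0≤g i = *-nonNegative (γ-nonNegative i) (⁻¹-nonNegative 0<q)

      g*𝓛≤ψ : ∀ i → g i * familyWeight ψ (𝓛 i) ≤ ψ i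
      g*𝓛≤ψ i = begin
        γ i / q * familyWeight ψ (𝓛 i)  ≈⟨ solve 3 (λ x y z → x :* y :* z := x :* z :* y) ≈-refl _ _ _ ⟩
        γ i * familyWeight ψ (𝓛 i) / q  ≤⟨ x≤y*z⇒x/z≤y 0<q (≤-trans (γ𝓛≤qψ i) (≤-reflexive (*-comm q (ψ i)))) ⟩
        ψ i                             ∎

      length-word : ∀ {w} → w ∈ˡ words (suc k) → length w ≡ suc k
      length-word w∈ with words⊆𝒲 (suc k) w∈
      ... | _ , _ , _ , _ , _ , |w|≡t = |w|≡t

      rescale : ∀ w {t} → length w ≡ t → productOver w γ ≈ productOver w g * q ^ t
      rescale []      ≡.refl = ≈-sym (*-identityˡ 1#)
      rescale (i ∷ w) ≡.refl = begin-equality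
        γ i * productOver w γ                         ≈⟨ *-cong (≈-sym (x/y*y≈x (γ i) 0<q)) (rescale w ≡.refl) ⟩
        γ i / q * q * (productOver w g * q ^ length w)
          ≈⟨ solve 4 (λ a b c d → a :* b :* (c :* d) := a :* c :* (b :* d)) ≈-refl _ _ _ _ ⟩
        γ i / q * productOver w g * (q * q ^ length w) ∎

-- The bound on the running time

theorem4 :
    (ℛ : CompleteOrderedField) (E : BinaryExponential ℛ)
    (let open CompleteOrderedField ℛ) (let open BinaryExponential E) (let open Probability ℛ)
    (n m : ℕ) (D : FlawDigraph n m)
    (ρ : Fin m → Fin n → Fin n → ℝ) → IsTransition D ρ →
    (θ : Fin n → ℝ) → IsDistribution θ →
    (μ : Fin n → ℝ) → IsDistribution μ → (∀ σ → 0# < μ σ) →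
    (𝒜 : FlawChoice D) (let open Walk D ρ θ 𝒜) (let open Charges D ρ θ μ)
    (Roots : Family m) (𝓛 : Fin m → Family m) → Traceable Roots 𝓛 →
    (ψ : Fin m → ℝ) → (∀ i → 0# < ψ i) →
    let ζ : Fin m → ℝ
        ζ i = γ i / ψ i * (∑[ S ∈ members (𝓛 i) ] (∏[ j ∈ elements S ] ψ j))
        δ : ℝ
        δ = 1# - (max[ i ∈ allFin m ] ζ i)
        T₀ : ℝ
        T₀ = log₂ (max[ σ ∈ allFin n ] (θ σ / μ σ))
             + log₂ (∑[ S ∈ members Roots ] (∏[ j ∈ elements S ] ψ j))
    in
    (∀ i → ζ i < 1#) →
    (s : ℝ) → 0# ≤ s →
    (k : ℕ) → IsFloor k (0# ⊔ ((T₀ + s) / δ)) →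
    1# - 2^ (- s) ≤ probSinkWithin k
theorem4 ℛ E n m D ρ ρ-transition θ θ-distribution μ μ-distribution 0<μ 𝒜 Roots 𝓛 traceable ψ 0<ψ ζ<1 s 0≤s k (_ , x<1+k) =
  1≤p+q⇒1-r≤p (1≤probSink+probNotSink k) notSink≤
  where
  open CompleteOrderedField ℛ
  open BinaryExponential E
  open Probability ℛ
  open Walk D ρ θ 𝒜
  open Charges D ρ θ μ
  open OrderedField ℛ
  open Exponential ℛ E
  open ForestWeights ℛ
  open RandomWalk.Analysis ℛ D ρ ρ-transition θ θ-distribution μ μ-distribution 0<μ 𝒜
  open Solver using (solve; _:=_; _:+_; _:*_; con)
  open ≤-Reasoning

  1≤p+q⇒1-r≤p : ∀ {p q r} → 1# ≤ p + q → q ≤ r → 1# - r ≤ p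
  1≤p+q⇒1-r≤p {p} {q} {r} 1≤p+q q≤r = +-cancelʳ-≤ r (begin
    1# - r + r ≈⟨ x-y+y≈x 1# r ⟩
    1#         ≤⟨ 1≤p+q ⟩
    p + q      ≤⟨ +-mono-≤ ≤-refl q≤r ⟩
    p + r      ∎)

  ζ : Fin m → ℝ
  ζ i = γ i / ψ i * familyWeight ψ (𝓛 i)

  maxζ δ T₀ x N : ℝ
  maxζ = max[ i ∈ allFin m ] ζ i
  δ = 1# - maxζ
  T₀ = log₂ density + log₂ (familyWeight ψ Roots)
  x = 0# ⊔ ((T₀ + s) / δ)
  N = fromℕ (suc k)

  0<N : 0# < N
  0<N = <-≤-trans 0<1 (x≤x+y (fromℕ-nonNegative k))

  maxζ<1 : maxζ < 1#
  maxζ<1 = max< (allFin m) 0<1 ζ<1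

  0<δ : 0# < δ
  0<δ = x<y⇒0<y-x maxζ<1

  δ≤1 : δ ≤ 1#
  δ≤1 = +-cancelʳ-≤ maxζ (≤-trans (≤-reflexive (x-y+y≈x 1# maxζ)) (x≤x+y (max-nonNegative ζ (allFin m))))

  0≤x : 0# ≤ x
  0≤x = x≤x⊔y 0# _

  -- Slightly below δ, so that q is positive even if every ζ i is 0.
  u q : ℝ
  u = x * δ / N
  q = 1# - u

  -- Lowering δ to u is paid for exactly by raising the number of steps from x to k + 1.
  u*N≈x*δ : u * N ≈ x * δ
  u*N≈x*δ = x/y*y≈x (x * δ) 0<N

  0≤u : 0# ≤ u
  0≤u = *-nonNegative (*-nonNegative 0≤x (proj₁ 0<δ)) (⁻¹-nonNegative 0<N)

  u≤δ : u ≤ δ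
  u≤δ = x≤y*z⇒x/z≤y 0<N (begin
    x * δ ≤⟨ *-monoˡ-≤ (proj₁ 0<δ) (proj₁ x<1+k) ⟩
    N * δ ≈⟨ *-comm N δ ⟩
    δ * N ∎)

  u<1 : u < 1#
  u<1 = ≰⇒> λ 1≤u → proj₂ x<1+k (≤-antisym (proj₁ x<1+k) (begin
    N      ≈⟨ *-identityˡ N ⟨
    1# * N ≤⟨ *-monoˡ-≤ (proj₁ 0<N) 1≤u ⟩
    u * N  ≈⟨ u*N≈x*δ ⟩
    x * δ  ≤⟨ *-monoʳ-≤ 0≤x δ≤1 ⟩
    x * 1# ≈⟨ *-identityʳ x ⟩
    x      ∎))

  0<q : 0# < q
  0<q = x<y⇒0<y-x u<1

  T₀+s≤N*u : T₀ + s ≤ N * u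
  T₀+s≤N*u = begin
    T₀ + s            ≈⟨ x/y*y≈x (T₀ + s) 0<δ ⟨
    (T₀ + s) / δ * δ  ≤⟨ *-monoˡ-≤ (proj₁ 0<δ) (x≤y⊔x _ _) ⟩
    x * δ             ≈⟨ u*N≈x*δ ⟨
    u * N             ≈⟨ *-comm u N ⟩
    N * u             ∎

  ζ≤q : ∀ i → ζ i ≤ q
  ζ≤q i = x+z≤y⇒x≤y-z u (begin
    ζ i + u           ≤⟨ +-mono-≤ (f≤max ζ (∈-allFin i)) u≤δ ⟩
    maxζ + (1# - maxζ) ≈⟨ +-comm maxζ δ ⟩
    1# - maxζ + maxζ  ≈⟨ x-y+y≈x 1# maxζ ⟩
    1#                ∎)

  γ𝓛≤qψ : ∀ i → γ i * familyWeight ψ (𝓛 i) ≤ q * ψ i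
  γ𝓛≤qψ i = x/z≤y⇒x≤y*z (0<ψ i) (begin
    γ i * familyWeight ψ (𝓛 i) / ψ i ≈⟨ solve 3 (λ x y z → x :* y :* z := x :* z :* y) ≈-refl _ _ _ ⟩
    ζ i                              ≤⟨ ζ≤q i ⟩
    q                                ∎)

  bound : probNotSinkWithin k ≤ density * familyWeight ψ Roots * q ^ suc k
  bound = probNotSink-≤ Roots 𝓛 traceable ψ (λ i → proj₁ (0<ψ i)) 0<q γ𝓛≤qψ k

  0≤Roots : 0# ≤ familyWeight ψ Roots
  0≤Roots = sum-nonNegative (members Roots) (λ S → product-nonNegative (elements S) (λ j → proj₁ (0<ψ j)))

  notSink≤ : probNotSinkWithin k ≤ 2^ (- s)
  notSink≤ with 0# ≈? familyWeight ψ Roots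
  -- Here `log₂` of the root sum is unspecified and so is T₀, but the bound on the failure
  -- probability is itself 0.
  ... | yes 0≈Roots = begin
    probNotSinkWithin k                          ≤⟨ bound ⟩
    density * familyWeight ψ Roots * q ^ suc k   ≈⟨ *-congʳ (*-congˡ 0≈Roots) ⟨
    density * 0# * q ^ suc k                     ≈⟨ solve 2 (λ x y → x :* con 0 :* y := con 0) ≈-refl _ _ ⟩
    0#                                           ≤⟨ 2^-nonNegative (- s) ⟩
    2^ (- s)                                     ∎
  -- After multiplication by 2^s, the factors 2^T₀ and 2^s merge into 2^(T₀ + s), at most 2^(Nu),
  -- which `q ^ suc k` compensates.
  ... | no 0≉Roots = *-cancelʳ-≤ (2^-positive s) (begin
    probNotSinkWithin k * 2^ s
      ≤⟨ *-monoˡ-≤ (2^-nonNegative s) bound ⟩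
    density * familyWeight ψ Roots * q ^ suc k * 2^ s
      ≈⟨ *-congʳ (*-congʳ (*-cong (2^-log₂ 0<density) (2^-log₂ (0≤Roots , 0≉Roots)))) ⟨
    2^ (log₂ density) * 2^ (log₂ (familyWeight ψ Roots)) * q ^ suc k * 2^ s
      ≈⟨ *-congʳ (*-congʳ (2^-+ _ _)) ⟨
    2^ T₀ * q ^ suc k * 2^ s
      ≈⟨ solve 3 (λ x y z → x :* y :* z := y :* (x :* z)) ≈-refl _ _ _ ⟩
    q ^ suc k * (2^ T₀ * 2^ s)
      ≈⟨ *-congˡ (2^-+ T₀ s) ⟨
    q ^ suc k * 2^ (T₀ + s)
      ≤⟨ *-monoʳ-≤ (^-nonNegative (proj₁ 0<q) (suc k)) (2^-mono-≤ T₀+s≤N*u) ⟩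
    q ^ suc k * 2^ (N * u)
      ≤⟨ [1-u]^k*2^ku≤1 0≤u (proj₁ u<1) (suc k) ⟩
    1#
      ≈⟨ 2^-inverse s ⟨
    2^ (- s) * 2^ s ∎)
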